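{- Let $f\in\mathbb{Q}[t]$ be a polynomial with at least two different complex roots. If $\deg f=4$ and $f(t)\neq f(-t)$ (as polynomials in $t$), then there exists a rational base change $t=\varphi(u)$ such that on the surface $\mathcal{E}_{f\circ\varphi}: y^2=x^3+f(\varphi(u))x$ there is a non-torsion section.
   Context: A rational base change $t=\varphi(u)$ is a non-constant rational function $\varphi\in\mathbb{Q}(u)$. A section on a surface $y^2=x^3+A(u)x+B(u)$ with $A,B\in\mathbb{Q}(u)$ (defined over $\mathbb{Q}$) is a point of this elliptic curve with coordinates in $\mathbb{Q}(u)$ (or the point at infinity); it is non-torsion if it has infinite order in the group of $\mathbb{Q}(u)$-rational points of this elliptic curve over $\mathbb{Q}(u)$. -}

module Defs where

open import Data.Nat as ℕ using (ℕ; zero; suc)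
import Data.Nat.Properties as ℕ
open import Data.Rational using (ℚ; 0ℚ; 1ℚ; ½; _+_; _*_; -_; _-_; ∣_∣; _<_; _≤_; 1/_; NonZero; Positive; positive; nonNegative; ≢-nonZero)
open import Data.Rational.Properties
open import Data.List using (List; []; _∷_; map)
open import Data.Product using (∃; _×_; _,_; proj₁; proj₂)
open import Data.Sum using (_⊎_; inj₁; inj₂)
open import Data.Unit using (⊤)
open import Relation.Nullary using (¬_; Dec; yes; no)
open import Relation.Nullary.Decidable using (map′; _×-dec_)
open import Relation.Binary.PropositionalEquality using (_≡_; refl; sym; trans; cong; cong₂; subst; module ≡-Reasoning)
open import Data.Rational.Solver using (module +-*-Solver)

-- Coefficient lists, constant term first.  Trailing zeros are allowed, so
-- equality of polynomials is _≈ₚ_, not _≡_.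
Poly : Set
Poly = List ℚ

coeff : Poly → ℕ → ℚ
coeff []      _       = 0ℚ
coeff (a ∷ f) zero    = a
coeff (a ∷ f) (suc n) = coeff f n

infix 4 _≈ₚ_
_≈ₚ_ : Poly → Poly → Set
f ≈ₚ g = ∀ n → coeff f n ≡ coeff g n

HasDegree : Poly → ℕ → Set
HasDegree f d = ¬ (coeff f d ≡ 0ℚ) × (∀ n → d ℕ.< n → coeff f n ≡ 0ℚ)

0ₚ 1ₚ X : Poly
0ₚ = []
1ₚ = 1ℚ ∷ []
X  = 0ℚ ∷ 1ℚ ∷ []

constₚ : ℚ → Poly
constₚ c = c ∷ []

infixl 6 _+ₚ_
infixl 7 _*ₚ_ _·ₚ_
infix  8 -ₚ_

_+ₚ_ : Poly → Poly → Poly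
[]      +ₚ g       = g
(a ∷ f) +ₚ []      = a ∷ f
(a ∷ f) +ₚ (b ∷ g) = a + b ∷ f +ₚ g

-ₚ_ : Poly → Poly
-ₚ f = map (λ a → - a) f

_·ₚ_ : ℚ → Poly → Poly
c ·ₚ f = map (c *_) f

_*ₚ_ : Poly → Poly → Poly
[]      *ₚ g = []
(a ∷ f) *ₚ g = a ·ₚ g +ₚ (0ℚ ∷ f *ₚ g)

-- Evaluation of a rational polynomial at an element of a ℚ-algebra A with
-- structure map ι, by Horner's rule.
evalWith : {A : Set} (ι : ℚ → A) (_⊕_ _⊗_ : A → A → A) → Poly → A → A
evalWith ι _⊕_ _⊗_ []      x = ι 0ℚ
evalWith ι _⊕_ _⊗_ (a ∷ f) x = ι a ⊕ (x ⊗ evalWith ι _⊕_ _⊗_ f x)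

infixr 9 _∘ₚ_
_∘ₚ_ : Poly → Poly → Poly
f ∘ₚ g = evalWith constₚ _+ₚ_ _*ₚ_ f g

infix 4 _≈ₚ?_
_≈ₚ?_ : (f g : Poly) → Dec (f ≈ₚ g)
[]      ≈ₚ? []      = yes λ _ → refl
[]      ≈ₚ? (b ∷ g) = map′ (λ { (p , q) zero → p ; (p , q) (suc n) → q n })
                           (λ h → h 0 , λ n → h (suc n))
                           ((0ℚ ≟ b) ×-dec ([] ≈ₚ? g))
(a ∷ f) ≈ₚ? []      = map′ (λ { (p , q) zero → p ; (p , q) (suc n) → q n })
                           (λ h → h 0 , λ n → h (suc n))
                           ((a ≟ 0ℚ) ×-dec (f ≈ₚ? []))
(a ∷ f) ≈ₚ? (b ∷ g) = map′ (λ { (p , q) zero → p ; (p , q) (suc n) → q n })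
                           (λ h → h 0 , λ n → h (suc n))
                           ((a ≟ b) ×-dec (f ≈ₚ? g))

coeff-+ₚ : ∀ f g n → coeff (f +ₚ g) n ≡ coeff f n + coeff g n
coeff-+ₚ []      g       n       = sym (+-identityˡ (coeff g n))
coeff-+ₚ (a ∷ f) []      n       = sym (+-identityʳ (coeff (a ∷ f) n))
coeff-+ₚ (a ∷ f) (b ∷ g) zero    = refl
coeff-+ₚ (a ∷ f) (b ∷ g) (suc n) = coeff-+ₚ f g n

coeff-·ₚ : ∀ c f n → coeff (c ·ₚ f) n ≡ c * coeff f n
coeff-·ₚ c []      n       = sym (*-zeroʳ c)
coeff-·ₚ c (a ∷ f) zero    = refl
coeff-·ₚ c (a ∷ f) (suc n) = coeff-·ₚ c f n

*-zero-product : ∀ {p q} → ¬ (p ≡ 0ℚ) → p * q ≡ 0ℚ → q ≡ 0ℚ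
*-zero-product {p} {q} p≢0 pq≡0 = begin
  q                ≡⟨ sym (*-identityˡ q) ⟩
  1ℚ * q           ≡⟨ cong (_* q) (sym (*-inverseˡ p)) ⟩
  (1/ p) * p * q   ≡⟨ *-assoc (1/ p) p q ⟩
  (1/ p) * (p * q) ≡⟨ cong ((1/ p) *_) pq≡0 ⟩
  (1/ p) * 0ℚ      ≡⟨ *-zeroʳ (1/ p) ⟩
  0ℚ               ∎
  where
  open ≡-Reasoning
  instance
    p-nonZero : NonZero p
    p-nonZero = ≢-nonZero p≢0

*ₚ-shiftʳ-zero : ∀ f g → coeff (f *ₚ (0ℚ ∷ g)) 0 ≡ 0ℚ
*ₚ-shiftʳ-zero []      g = refl
*ₚ-shiftʳ-zero (a ∷ f) g = trans (+-identityʳ (a * 0ℚ)) (*-zeroʳ a)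

*ₚ-shiftʳ-suc : ∀ f g n → coeff (f *ₚ (0ℚ ∷ g)) (suc n) ≡ coeff (f *ₚ g) n
*ₚ-shiftʳ-suc []      g n    = refl
*ₚ-shiftʳ-suc (a ∷ f) g zero = begin
  coeff (a ·ₚ g +ₚ f *ₚ (0ℚ ∷ g)) 0           ≡⟨ coeff-+ₚ (a ·ₚ g) (f *ₚ (0ℚ ∷ g)) 0 ⟩
  coeff (a ·ₚ g) 0 + coeff (f *ₚ (0ℚ ∷ g)) 0  ≡⟨ cong (coeff (a ·ₚ g) 0 +_) (*ₚ-shiftʳ-zero f g) ⟩
  coeff (a ·ₚ g) 0 + 0ℚ                       ≡⟨ sym (coeff-+ₚ (a ·ₚ g) (0ℚ ∷ f *ₚ g) 0) ⟩
  coeff (a ·ₚ g +ₚ (0ℚ ∷ f *ₚ g)) 0           ∎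
  where open ≡-Reasoning
*ₚ-shiftʳ-suc (a ∷ f) g (suc n) = begin
  coeff (a ·ₚ g +ₚ f *ₚ (0ℚ ∷ g)) (suc n)                 ≡⟨ coeff-+ₚ (a ·ₚ g) (f *ₚ (0ℚ ∷ g)) (suc n) ⟩
  coeff (a ·ₚ g) (suc n) + coeff (f *ₚ (0ℚ ∷ g)) (suc n)  ≡⟨ cong (coeff (a ·ₚ g) (suc n) +_) (*ₚ-shiftʳ-suc f g n) ⟩
  coeff (a ·ₚ g) (suc n) + coeff (f *ₚ g) n               ≡⟨ sym (coeff-+ₚ (a ·ₚ g) (0ℚ ∷ f *ₚ g) (suc n)) ⟩
  coeff (a ·ₚ g +ₚ (0ℚ ∷ f *ₚ g)) (suc n)                 ∎
  where open ≡-Reasoning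

*ₚ-cancel-unit : ∀ a f g → ¬ (a ≡ 0ℚ) → (a ∷ f) *ₚ g ≈ₚ 0ₚ → g ≈ₚ 0ₚ
*ₚ-cancel-unit a f []      a≢0 h = λ _ → refl
*ₚ-cancel-unit a f (b ∷ g) a≢0 h with *-zero-product a≢0 (trans (sym (+-identityʳ (a * b))) (h 0))
... | refl = λ { zero    → refl
               ; (suc n) → *ₚ-cancel-unit a f g a≢0
                   (λ k → trans (sym (*ₚ-shiftʳ-suc (a ∷ f) g k)) (h (suc k))) n }

*ₚ-zero-product : ∀ f g → f *ₚ g ≈ₚ 0ₚ → f ≈ₚ 0ₚ ⊎ g ≈ₚ 0ₚ
*ₚ-zero-product []      g h = inj₁ λ _ → refl
*ₚ-zero-product (a ∷ f) g h with a ≟ 0ℚ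
... | no a≢0  = inj₂ (*ₚ-cancel-unit a f g a≢0 h)
... | yes refl with *ₚ-zero-product f g (λ n → begin
    coeff (f *ₚ g) n                                    ≡⟨ sym (+-identityˡ _) ⟩
    0ℚ + coeff (f *ₚ g) n                               ≡⟨ cong (_+ coeff (f *ₚ g) n) (sym (trans (coeff-·ₚ 0ℚ g (suc n)) (*-zeroˡ (coeff g (suc n))))) ⟩
    coeff (0ℚ ·ₚ g) (suc n) + coeff (f *ₚ g) n          ≡⟨ sym (coeff-+ₚ (0ℚ ·ₚ g) (0ℚ ∷ f *ₚ g) (suc n)) ⟩
    coeff (0ℚ ·ₚ g +ₚ (0ℚ ∷ f *ₚ g)) (suc n)            ≡⟨ h (suc n) ⟩
    0ℚ                                                  ∎)
  where open ≡-Reasoning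
...   | inj₁ f≈0 = inj₁ λ { zero → refl ; (suc n) → f≈0 n }
...   | inj₂ g≈0 = inj₂ g≈0

*ₚ-nonzero : ∀ {f g} → ¬ (f ≈ₚ 0ₚ) → ¬ (g ≈ₚ 0ₚ) → ¬ (f *ₚ g ≈ₚ 0ₚ)
*ₚ-nonzero {f} {g} f≉0 g≉0 h with *ₚ-zero-product f g h
... | inj₁ f≈0 = f≉0 f≈0
... | inj₂ g≈0 = g≉0 g≈0

1ₚ≉0ₚ : ¬ (1ₚ ≈ₚ 0ₚ)
1ₚ≉0ₚ h with h 0
... | ()

-- Fractions need not be in lowest terms; equality is _≈_.
record RatFun : Set where
  constructor mkRatFun
  field
    num   : Poly
    den   : Poly
    den≉0 : ¬ (den ≈ₚ 0ₚ)

open RatFun public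

infix 4 _≈_ _≈?_
_≈_ : RatFun → RatFun → Set
r ≈ s = num r *ₚ den s ≈ₚ num s *ₚ den r

_≈?_ : (r s : RatFun) → Dec (r ≈ s)
r ≈? s = num r *ₚ den s ≈ₚ? num s *ₚ den r

const : ℚ → RatFun
const c = mkRatFun (constₚ c) 1ₚ 1ₚ≉0ₚ

infixl 6 _+ᵣ_ _-ᵣ_
infixl 7 _*ᵣ_ _÷ᵣ_
infix  8 -ᵣ_

_+ᵣ_ : RatFun → RatFun → RatFun
r +ᵣ s = mkRatFun (num r *ₚ den s +ₚ num s *ₚ den r) (den r *ₚ den s)
                  (*ₚ-nonzero {den r} {den s} (den≉0 r) (den≉0 s))

_*ᵣ_ : RatFun → RatFun → RatFun
r *ᵣ s = mkRatFun (num r *ₚ num s) (den r *ₚ den s)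
                  (*ₚ-nonzero {den r} {den s} (den≉0 r) (den≉0 s))

-ᵣ_ : RatFun → RatFun
-ᵣ r = mkRatFun (-ₚ num r) (den r) (den≉0 r)

_-ᵣ_ : RatFun → RatFun → RatFun
r -ᵣ s = r +ᵣ (-ᵣ s)

-- Totalised by inv 0 = 0.
inv : RatFun → RatFun
inv r with num r ≈ₚ? 0ₚ
... | yes _     = const 0ℚ
... | no  num≉0 = mkRatFun (den r) (num r) num≉0

_÷ᵣ_ : RatFun → RatFun → RatFun
r ÷ᵣ s = r *ᵣ inv s

infixr 9 _∘ᵣ_
_∘ᵣ_ : Poly → RatFun → RatFun
f ∘ᵣ φ = evalWith const _+ᵣ_ _*ᵣ_ f φ

NonConstant : RatFun → Set
NonConstant φ = ¬ (∃ λ c → φ ≈ const c)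

data Point : Set where
  ∞      : Point
  affine : (x y : RatFun) → Point

OnCurve : (A B : RatFun) → Point → Set
OnCurve A B ∞            = ⊤
OnCurve A B (affine x y) = y *ᵣ y ≈ x *ᵣ x *ᵣ x +ᵣ A *ᵣ x +ᵣ B

-- The third intersection point of the line of slope m through (x₁ , y₁)
-- and a point of abscissa x₂, reflected in the x-axis.
thirdPoint : (m x₁ y₁ x₂ : RatFun) → Point
thirdPoint m x₁ y₁ x₂ = affine x₃ (m *ᵣ (x₁ -ᵣ x₃) -ᵣ y₁)
  where
  x₃ : RatFun
  x₃ = m *ᵣ m -ᵣ x₁ -ᵣ x₂

-- The chord–tangent group law; it does not involve B.  It is defined on all
-- points of the plane but is meaningful only on those of the curve, where
-- x₁ ≈ x₂ and y₁ ≉ - y₂ force y₁ ≈ y₂ ≉ 0, so every denominator below is nonzero.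
add : (A : RatFun) → Point → Point → Point
add A ∞              Q              = Q
add A (affine x₁ y₁) ∞              = affine x₁ y₁
add A (affine x₁ y₁) (affine x₂ y₂) with x₁ ≈? x₂ | y₁ ≈? (-ᵣ y₂)
... | no  _ | _     = thirdPoint ((y₂ -ᵣ y₁) ÷ᵣ (x₂ -ᵣ x₁)) x₁ y₁ x₂
... | yes _ | yes _ = ∞
... | yes _ | no  _ = thirdPoint ((const 3ℚ *ᵣ (x₁ *ᵣ x₁) +ᵣ A) ÷ᵣ (const 2ℚ *ᵣ y₁)) x₁ y₁ x₂
  where
  2ℚ 3ℚ : ℚ
  2ℚ = 1ℚ + 1ℚ
  3ℚ = 2ℚ + 1ℚ

multiple : (A : RatFun) → ℕ → Point → Point
multiple A zero    P = ∞
multiple A (suc n) P = add A P (multiple A n P)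

NonTorsion : (A : RatFun) → Point → Set
NonTorsion A P = ∀ n → multiple A n P ≡ ∞ → n ≡ 0

record ℝ : Set where
  constructor mkℝ
  field
    seq    : ℕ → ℚ
    cauchy : ∀ ε → 0ℚ < ε → ∃ λ N → ∀ m n → N ℕ.≤ m → N ℕ.≤ n → ∣ seq m - seq n ∣ < ε

open ℝ public

infix 4 _≈ʳ_
_≈ʳ_ : ℝ → ℝ → Set
x ≈ʳ y = ∀ ε → 0ℚ < ε → ∃ λ N → ∀ n → N ℕ.≤ n → ∣ seq x n - seq y n ∣ < ε

private
  half-pos : ∀ {ε} → 0ℚ < ε → 0ℚ < ½ * ε
  half-pos {ε} 0<ε = subst (_< ½ * ε) (*-zeroʳ ½) (*-monoʳ-<-pos ½ 0<ε)

  half+half : ∀ ε → ½ * ε + ½ * ε ≡ ε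
  half+half ε = trans (sym (*-distribʳ-+ ε ½ ½)) (*-identityˡ ε)

  ∣+∣<ε : ∀ {ε} p q → ∣ p ∣ < ½ * ε → ∣ q ∣ < ½ * ε → ∣ p + q ∣ < ε
  ∣+∣<ε {ε} p q p< q< =
    ≤-<-trans (∣p+q∣≤∣p∣+∣q∣ p q) (subst (∣ p ∣ + ∣ q ∣ <_) (half+half ε) (+-mono-< p< q<))

  bounded : (x : ℝ) → ∃ λ b → 0ℚ < b × ∃ λ N → ∀ n → N ℕ.≤ n → ∣ seq x n ∣ ≤ b
  bounded x with cauchy x 1ℚ (positive⁻¹ 1ℚ)
  ... | N , c = 1ℚ + ∣ seq x N ∣
              , +-mono-<-≤ (positive⁻¹ 1ℚ) (0≤∣p∣ (seq x N))
              , N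
              , λ n N≤n → ≤-trans
                  (≤-reflexive (cong ∣_∣ (solve 2 (λ a b → a := (a :- b) :+ b) refl (seq x n) (seq x N))))
                  (≤-trans (∣p+q∣≤∣p∣+∣q∣ (seq x n - seq x N) (seq x N))
                           (+-monoˡ-≤ ∣ seq x N ∣ (<⇒≤ (c n N N≤n ℕ.≤-refl))))
    where open +-*-Solver

  scaled : ∀ b ε → 0ℚ < b → 0ℚ < ε →
           ∃ λ δ → 0ℚ < δ × (∀ p q → ∣ p ∣ ≤ b → ∣ q ∣ < δ → ∣ p * q ∣ < ε)
  scaled b ε 0<b 0<ε = δ , positive⁻¹ δ {{δ-pos}} , λ p q p≤b q<δ → begin-strict
      ∣ p * q ∣     ≡⟨ ∣p*q∣≡∣p∣*∣q∣ p q ⟩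
      ∣ p ∣ * ∣ q ∣ ≤⟨ *-monoʳ-≤-nonNeg ∣ q ∣ {{nonNegative (0≤∣p∣ q)}} p≤b ⟩
      b * ∣ q ∣     <⟨ *-monoʳ-<-pos b q<δ ⟩
      b * δ         ≡⟨ sym (*-assoc b (1/ b) ε) ⟩
      b * 1/ b * ε  ≡⟨ cong (_* ε) (*-inverseʳ b) ⟩
      1ℚ * ε        ≡⟨ *-identityˡ ε ⟩
      ε             ∎
    where
    open ≤-Reasoning
    instance
      b-pos : Positive b
      b-pos = positive 0<b
      b-nonZero : NonZero b
      b-nonZero = pos⇒nonZero b
      ε-pos : Positive ε
      ε-pos = positive 0<ε
    δ : ℚ
    δ = 1/ b * ε
    δ-pos : Positive δ
    δ-pos = pos*pos⇒pos (1/ b) {{1/pos⇒pos b}} ε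

  product-difference : ∀ a b a′ b′ → a * (b - b′) + b′ * (a - a′) ≡ a * b - a′ * b′
  product-difference a b a′ b′ = begin
    a * (b - b′) + b′ * (a - a′)                  ≡⟨ cong₂ _+_ (*-distribˡ-+ a b (- b′)) (*-distribˡ-+ b′ a (- a′)) ⟩
    a * b + a * - b′ + (b′ * a + b′ * - a′)       ≡⟨ cong₂ (λ p q → a * b + p + (b′ * a + q)) (sym (neg-distribʳ-* a b′)) (sym (neg-distribʳ-* b′ a′)) ⟩
    a * b - a * b′ + (b′ * a - b′ * a′)           ≡⟨ cong₂ (λ p q → a * b - a * b′ + (p - q)) (*-comm b′ a) (*-comm b′ a′) ⟩
    a * b - a * b′ + (a * b′ - a′ * b′)           ≡⟨ +-assoc (a * b) (- (a * b′)) _ ⟩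
    a * b + (- (a * b′) + (a * b′ - a′ * b′))     ≡⟨ cong (a * b +_) (sym (+-assoc (- (a * b′)) (a * b′) _)) ⟩
    a * b + (- (a * b′) + a * b′ - a′ * b′)       ≡⟨ cong (λ p → a * b + (p - a′ * b′)) (+-inverseˡ (a * b′)) ⟩
    a * b + (0ℚ - a′ * b′)                        ≡⟨ cong (a * b +_) (+-identityˡ _) ⟩
    a * b - a′ * b′                               ∎
    where open ≡-Reasoning

infixl 6 _+ʳ_ _-ʳ_
infixl 7 _*ʳ_
infix  8 -ʳ_

ιʳ : ℚ → ℝ
ιʳ c = mkℝ (λ _ → c) λ ε 0<ε → 0 , λ _ _ _ _ → subst (λ z → ∣ z ∣ < ε) (sym (+-inverseʳ c)) 0<ε

_+ʳ_ : ℝ → ℝ → ℝ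
x +ʳ y = mkℝ (λ n → seq x n + seq y n) go
  where
  go : ∀ ε → 0ℚ < ε → ∃ λ N → ∀ m n → N ℕ.≤ m → N ℕ.≤ n →
       ∣ (seq x m + seq y m) - (seq x n + seq y n) ∣ < ε
  go ε 0<ε with cauchy x (½ * ε) (half-pos 0<ε) | cauchy y (½ * ε) (half-pos 0<ε)
  ... | M , c | N , d = M ℕ.⊔ N , λ m n M≤m N≤n →
    subst (λ z → ∣ z ∣ < ε)
      (solve 4 (λ a b a′ b′ → (a :- a′) :+ (b :- b′) := (a :+ b) :- (a′ :+ b′)) refl
        (seq x m) (seq y m) (seq x n) (seq y n))
      (∣+∣<ε (seq x m - seq x n) (seq y m - seq y n)
        (c m n (ℕ.m⊔n≤o⇒m≤o M N M≤m) (ℕ.m⊔n≤o⇒m≤o M N N≤n))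
        (d m n (ℕ.m⊔n≤o⇒n≤o M N M≤m) (ℕ.m⊔n≤o⇒n≤o M N N≤n)))
    where open +-*-Solver

-ʳ_ : ℝ → ℝ
-ʳ x = mkℝ (λ n → - seq x n) λ ε 0<ε → proj₁ (cauchy x ε 0<ε) , λ m n M≤m M≤n →
  subst (_< ε)
    (trans (sym (∣-p∣≡∣p∣ (seq x m - seq x n))) (cong ∣_∣ (neg-distrib-+ (seq x m) (- seq x n))))
    (proj₂ (cauchy x ε 0<ε) m n M≤m M≤n)

_-ʳ_ : ℝ → ℝ → ℝ
x -ʳ y = x +ʳ (-ʳ y)

_*ʳ_ : ℝ → ℝ → ℝ
x *ʳ y = mkℝ (λ n → seq x n * seq y n) go
  where
  go : ∀ ε → 0ℚ < ε → ∃ λ N → ∀ m n → N ℕ.≤ m → N ℕ.≤ n →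
       ∣ seq x m * seq y m - seq x n * seq y n ∣ < ε
  go ε 0<ε =
    let b  , 0<b  , B  , x≤b  = bounded x
        b′ , 0<b′ , B′ , y≤b′ = bounded y
        δ  , 0<δ  , s  = scaled b (½ * ε) 0<b (half-pos 0<ε)
        δ′ , 0<δ′ , s′ = scaled b′ (½ * ε) 0<b′ (half-pos 0<ε)
        M  , c  = cauchy y δ 0<δ
        M′ , c′ = cauchy x δ′ 0<δ′
    in (B ℕ.⊔ B′) ℕ.⊔ (M ℕ.⊔ M′) , λ m n K≤m K≤n →
    let L≤m = ℕ.m⊔n≤o⇒m≤o (B ℕ.⊔ B′) (M ℕ.⊔ M′) K≤m
        R≤m = ℕ.m⊔n≤o⇒n≤o (B ℕ.⊔ B′) (M ℕ.⊔ M′) K≤m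
        L≤n = ℕ.m⊔n≤o⇒m≤o (B ℕ.⊔ B′) (M ℕ.⊔ M′) K≤n
        R≤n = ℕ.m⊔n≤o⇒n≤o (B ℕ.⊔ B′) (M ℕ.⊔ M′) K≤n
    in subst (λ z → ∣ z ∣ < ε)
      (product-difference (seq x m) (seq y m) (seq x n) (seq y n))
      (∣+∣<ε (seq x m * (seq y m - seq y n)) (seq y n * (seq x m - seq x n))
        (s (seq x m) (seq y m - seq y n) (x≤b m (ℕ.m⊔n≤o⇒m≤o B B′ L≤m))
          (c m n (ℕ.m⊔n≤o⇒m≤o M M′ R≤m) (ℕ.m⊔n≤o⇒m≤o M M′ R≤n)))
        (s′ (seq y n) (seq x m - seq x n) (y≤b′ n (ℕ.m⊔n≤o⇒n≤o B B′ L≤n))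
          (c′ m n (ℕ.m⊔n≤o⇒n≤o M M′ R≤m) (ℕ.m⊔n≤o⇒n≤o M M′ R≤n))))

record ℂ : Set where
  constructor _+i_
  field
    re im : ℝ

open ℂ public

infix 4 _≈ᶜ_
_≈ᶜ_ : ℂ → ℂ → Set
z ≈ᶜ w = re z ≈ʳ re w × im z ≈ʳ im w

infixl 6 _+ᶜ_
infixl 7 _*ᶜ_

ιᶜ : ℚ → ℂ
ιᶜ c = ιʳ c +i ιʳ 0ℚ

_+ᶜ_ : ℂ → ℂ → ℂ
z +ᶜ w = (re z +ʳ re w) +i (im z +ʳ im w)

_*ᶜ_ : ℂ → ℂ → ℂ
z *ᶜ w = (re z *ʳ re w -ʳ im z *ʳ im w) +i (re z *ʳ im w +ʳ im z *ʳ re w)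

IsRoot : Poly → ℂ → Set
IsRoot f z = evalWith ιᶜ _+ᶜ_ _*ᶜ_ f z ≈ᶜ ιᶜ 0ℚ

TwoDistinctComplexRoots : Poly → Set
TwoDistinctComplexRoots f = ∃ λ z → ∃ λ w → ¬ (z ≈ᶜ w) × IsRoot f z × IsRoot f w

{-# OPTIONS --safe #-}

-- Completing squares, f = a ((s² + h)² + D s + E) with s = t + β.  If D ≠ 0, then for m = 1 / u the
-- equation D s + E = 4 a m⁴ defines s, and with k = 2 a m² and μ = (s² + h) / (2 m) one gets
-- f = k² + 2 k μ², so (μ² , μ (μ² + k)) is a point.  If D = 0 ≠ E, a Möbius substitution s = ρ + 1 / T
-- moves ∞ to a point where the sextic covariant of the quartic does not vanish, which brings back the
-- case D ≠ 0 up to a twist by a fourth power.  If D = E = 0 ≠ h, then f = a (s² + h)², the surface is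
-- the quadratic twist of the constant curve y² = x³ + a x by s² + h, and a rational curve on it is
-- found by making x and x² + a norms.  If D = E = h = 0, then f has only one root.
-- In each case f / x² vanishes at u = 0: after rescaling, the curve reduces there to the cuspidal cubic
-- y² = x³ and the point to a smooth point other than ∞.  The smooth points form the additive group of
-- ℚ, which is torsion-free, so the section has infinite order.
module Submission where

open import Defs
open import Algebra.Bundles using (CommutativeRing)
import Algebra.Solver.Ring
import Algebra.Solver.Ring.AlmostCommutativeRing as ACR
open import Algebra.Structures using (IsCommutativeRing)
import Data.Integer.Base as ℤ
open import Data.List.Base using ([]; _∷_)
open import Data.Maybe.Base using (Maybe; just; nothing)
open import Data.Nat.Base as ℕ using (ℕ; zero; suc; s≤s; z≤n)
import Data.Nat.Properties as ℕ
open import Data.Product using (∃; ∃₂; _×_; _,_; proj₁; proj₂)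
open import Data.Rational as ℚ using (ℚ; 0ℚ; 1ℚ; ½)
import Data.Rational.Properties as ℚ
open import Data.Rational.Solver using (module +-*-Solver)
open import Data.Sum using (inj₁; inj₂; [_,_]′)
open import Level using (0ℓ)
open import Relation.Binary using (IsEquivalence; Setoid)
open import Relation.Binary.PropositionalEquality using (_≡_; _≢_; refl; sym; trans; cong; cong₂; subst; isEquivalence; module ≡-Reasoning)
import Relation.Binary.Reasoning.Setoid as SetoidReasoning
open import Relation.Nullary using (¬_; yes; no; contradiction)
open import Relation.Nullary.Decidable using (from-yes)

-- ℚ-algebras and the polynomial ring

-- For a quartic with distinct roots, the sextic covariant vanishes at the fixed points of the
-- involutions of the projective line that pair off the roots. D = 0 expresses the symmetry s ↦ -s,
-- which fixes ∞. For a ((s² + h)² + E) the covariant is a multiple of E s (h² + E - s⁴), so when E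
-- ≠ 0 a rational ρ off its zeros can be moved to ∞. When E = 0 the covariant vanishes identically,
-- and this is why the square a (s² + h)² needs a curve of a different origin. The term 4 a m⁴
-- serves to make both x and x² + f squares. For x = μ² and f = k² + 2 k μ² one has x² + f = (x +
-- k)², and k = 2 a m² splits a V² + 4 a² m⁴, where V = s² + h, into 2 k μ² and k². With m = 1 / u,
-- the pole of s at u = 0 has order 4, that of V order 8 and that of x order 14, so f / x² vanishes
-- there to order 12.

record ℚ-Algebra : Set₁ where
  field
    commutativeRing : CommutativeRing 0ℓ 0ℓ
  open CommutativeRing commutativeRing public
    renaming (refl to ≈-refl; sym to ≈-sym; trans to ≈-trans; _≈_ to infix 4 _~_)
  field
    ι      : ℚ → Carrier
    ι-+    : ∀ p q → ι (p ℚ.+ q) ~ ι p + ι q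
    ι-*    : ∀ p q → ι (p ℚ.* q) ~ ι p * ι q
    ι-neg  : ∀ p → ι (ℚ.- p) ~ - ι p
    ι-0    : ι 0ℚ ~ 0#
    ι-1    : ι 1ℚ ~ 1#

  infix 4 _≁_
  _≁_ : Carrier → Carrier → Set
  x ≁ y = ¬ (x ~ y)

  -- These are images of rationals because the solver constants `con 0ℚ` and `con 1ℚ` denote exactly
  -- them. In ℚ[X], `0#` is the empty list and `ι 0ℚ` is not.
  𝟘 𝟙 : Carrier
  𝟘 = ι 0ℚ
  𝟙 = ι 1ℚ

  ι-cong : ∀ {p q} → p ≡ q → ι p ~ ι q
  ι-cong p≡q = reflexive (cong ι p≡q)

  ι-+′ : ∀ {p q x y} → ι p ~ x → ι q ~ y → ι (p ℚ.+ q) ~ x + y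
  ι-+′ {p} {q} p~x q~y = ≈-trans (ι-+ p q) (+-cong p~x q~y)

  ι-*′ : ∀ {p q x y} → ι p ~ x → ι q ~ y → ι (p ℚ.* q) ~ x * y
  ι-*′ {p} {q} p~x q~y = ≈-trans (ι-* p q) (*-cong p~x q~y)

  private
    ι-homomorphism : CommutativeRing.rawRing ℚ.+-*-commutativeRing
                     ACR.-Raw-AlmostCommutative⟶ ACR.fromCommutativeRing commutativeRing
    ι-homomorphism = record
      { ⟦_⟧ = ι ; +-homo = ι-+ ; *-homo = ι-* ; -‿homo = ι-neg ; 0-homo = ι-0 ; 1-homo = ι-1 }

    ι-≟ : ∀ p q → Maybe (ι p ~ ι q)
    ι-≟ p q with p ℚ.≟ q
    ... | yes p≡q = just (ι-cong p≡q)
    ... | no  _   = nothing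

  module Solver = Algebra.Solver.Ring (CommutativeRing.rawRing ℚ.+-*-commutativeRing)
                    (ACR.fromCommutativeRing commutativeRing) ι-homomorphism ι-≟

  -- Reduces an equation that holds modulo the hypothesis a ~ b to an identity.
  modulo : ∀ {x y a b} c → a ~ b → x ~ y + c * (a - b) → x ~ y
  modulo {x} {y} {a} {b} c a~b x~ = begin
    x                 ≈⟨ x~ ⟩
    y + c * (a - b)   ≈⟨ +-congˡ (*-congˡ (+-congʳ a~b)) ⟩
    y + c * (b - b)   ≈⟨ solve 3 (λ y b c → y :+ c :* (b :- b) := y) ≈-refl y b c ⟩
    y                 ∎
    where
    open SetoidReasoning setoid
    open Solver

  inverse-unique : ∀ {x y z} → x * y ~ 𝟙 → x * z ~ 𝟙 → y ~ z
  inverse-unique {x} {y} {z} xy~1 xz~1 = modulo z xy~1 (modulo (- y) xz~1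
    (solve 3 (λ x y z → y := z :+ z :* (x :* y :- con 1ℚ) :+ (:- y) :* (x :* z :- con 1ℚ)) ≈-refl x y z))
    where open Solver

  evaluate : Poly → Carrier → Carrier
  evaluate = evalWith ι _+_ _*_

  evaluate-zero : ∀ f x → f ≈ₚ 0ₚ → evaluate f x ~ 𝟘
  evaluate-zero []      x f≈0 = ≈-refl
  evaluate-zero (a ∷ f) x f≈0 = ≈-trans
    (+-cong (ι-cong (f≈0 0)) (*-congˡ (evaluate-zero f x λ n → f≈0 (suc n))))
    (solve 1 (λ x → con 0ℚ :+ x :* con 0ℚ := con 0ℚ) ≈-refl x)
    where open Solver

module PolynomialRing where
  open import Data.Rational using (_+_; _*_; -_)

  -- A wrapper of _≈ₚ_ from which unification can recover the two polynomials.
  infix 4 _≋_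
  record _≋_ (f g : Poly) : Set where
    constructor pointwise
    field
      at : f ≈ₚ g

  open _≋_

  ≋-refl : ∀ {f} → f ≋ f
  ≋-refl = pointwise λ n → refl

  ≋-sym : ∀ {f g} → f ≋ g → g ≋ f
  ≋-sym f≋g = pointwise λ n → sym (at f≋g n)

  ≋-trans : ∀ {f g h} → f ≋ g → g ≋ h → f ≋ h
  ≋-trans f≋g g≋h = pointwise λ n → trans (at f≋g n) (at g≋h n)

  ∷-cong : ∀ {a b f g} → a ≡ b → f ≋ g → a ∷ f ≋ b ∷ g
  ∷-cong a≡b f≋g = pointwise λ { zero → a≡b ; (suc n) → at f≋g n }

  +ₚ-cong : ∀ {f f′ g g′} → f ≋ f′ → g ≋ g′ → f +ₚ g ≋ f′ +ₚ g′
  +ₚ-cong {f} {f′} {g} {g′} f≋f′ g≋g′ = pointwise λ n →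
    trans (coeff-+ₚ f g n) (trans (cong₂ _+_ (at f≋f′ n) (at g≋g′ n)) (sym (coeff-+ₚ f′ g′ n)))

  +ₚ-assoc : ∀ f g h → (f +ₚ g) +ₚ h ≋ f +ₚ (g +ₚ h)
  +ₚ-assoc f g h = pointwise λ n → begin
    coeff ((f +ₚ g) +ₚ h) n             ≡⟨ coeff-+ₚ (f +ₚ g) h n ⟩
    coeff (f +ₚ g) n + coeff h n        ≡⟨ cong (_+ coeff h n) (coeff-+ₚ f g n) ⟩
    coeff f n + coeff g n + coeff h n   ≡⟨ ℚ.+-assoc (coeff f n) (coeff g n) (coeff h n) ⟩
    coeff f n + (coeff g n + coeff h n) ≡⟨ cong (coeff f n +_) (coeff-+ₚ g h n) ⟨
    coeff f n + coeff (g +ₚ h) n        ≡⟨ coeff-+ₚ f (g +ₚ h) n ⟨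
    coeff (f +ₚ (g +ₚ h)) n             ∎
    where open ≡-Reasoning

  +ₚ-comm : ∀ f g → f +ₚ g ≋ g +ₚ f
  +ₚ-comm f g = pointwise λ n →
    trans (coeff-+ₚ f g n) (trans (ℚ.+-comm (coeff f n) (coeff g n)) (sym (coeff-+ₚ g f n)))

  coeff-neg : ∀ f n → coeff (-ₚ f) n ≡ - coeff f n
  coeff-neg []      n       = refl
  coeff-neg (a ∷ f) zero    = refl
  coeff-neg (a ∷ f) (suc n) = coeff-neg f n

  -ₚ-cong : ∀ {f g} → f ≋ g → -ₚ f ≋ -ₚ g
  -ₚ-cong {f} {g} f≋g = pointwise λ n → trans (coeff-neg f n) (trans (cong -_ (at f≋g n)) (sym (coeff-neg g n)))

  -ₚ-inverseʳ : ∀ f → f +ₚ -ₚ f ≋ 0ₚ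
  -ₚ-inverseʳ f = pointwise λ n → trans (coeff-+ₚ f (-ₚ f) n)
    (trans (cong (coeff f n +_) (coeff-neg f n)) (ℚ.+-inverseʳ (coeff f n)))

  ·ₚ-cong : ∀ c {f g} → f ≋ g → c ·ₚ f ≋ c ·ₚ g
  ·ₚ-cong c {f} {g} f≋g = pointwise λ n →
    trans (coeff-·ₚ c f n) (trans (cong (c *_) (at f≋g n)) (sym (coeff-·ₚ c g n)))

  ·ₚ-distrib-+ₚ : ∀ c f g → c ·ₚ (f +ₚ g) ≋ c ·ₚ f +ₚ c ·ₚ g
  ·ₚ-distrib-+ₚ c f g = pointwise λ n → begin
    coeff (c ·ₚ (f +ₚ g)) n               ≡⟨ coeff-·ₚ c (f +ₚ g) n ⟩
    c * coeff (f +ₚ g) n                  ≡⟨ cong (c *_) (coeff-+ₚ f g n) ⟩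
    c * (coeff f n + coeff g n)           ≡⟨ ℚ.*-distribˡ-+ c (coeff f n) (coeff g n) ⟩
    c * coeff f n + c * coeff g n         ≡⟨ cong₂ _+_ (coeff-·ₚ c f n) (coeff-·ₚ c g n) ⟨
    coeff (c ·ₚ f) n + coeff (c ·ₚ g) n   ≡⟨ coeff-+ₚ (c ·ₚ f) (c ·ₚ g) n ⟨
    coeff (c ·ₚ f +ₚ c ·ₚ g) n            ∎
    where open ≡-Reasoning

  ·ₚ-assoc : ∀ c d f → (c * d) ·ₚ f ≋ c ·ₚ (d ·ₚ f)
  ·ₚ-assoc c d f = pointwise λ n → begin
    coeff ((c * d) ·ₚ f) n   ≡⟨ coeff-·ₚ (c * d) f n ⟩
    c * d * coeff f n        ≡⟨ ℚ.*-assoc c d (coeff f n) ⟩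
    c * (d * coeff f n)      ≡⟨ cong (c *_) (coeff-·ₚ d f n) ⟨
    c * coeff (d ·ₚ f) n     ≡⟨ coeff-·ₚ c (d ·ₚ f) n ⟨
    coeff (c ·ₚ (d ·ₚ f)) n  ∎
    where open ≡-Reasoning

  0·ₚ : ∀ f → 0ℚ ·ₚ f ≋ 0ₚ
  0·ₚ f = pointwise λ n → trans (coeff-·ₚ 0ℚ f n) (ℚ.*-zeroˡ (coeff f n))

  1·ₚ : ∀ f → 1ℚ ·ₚ f ≋ f
  1·ₚ f = pointwise λ n → trans (coeff-·ₚ 1ℚ f n) (ℚ.*-identityˡ (coeff f n))

  +ₚ-identityʳ : ∀ f → f +ₚ 0ₚ ≋ f
  +ₚ-identityʳ f = pointwise λ n → trans (coeff-+ₚ f 0ₚ n) (ℚ.+-identityʳ (coeff f n))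

  0∷0ₚ : 0ℚ ∷ 0ₚ ≋ 0ₚ
  0∷0ₚ = pointwise λ { zero → refl ; (suc n) → refl }

  +ₚ-interchange : ∀ f g h k → (f +ₚ g) +ₚ (h +ₚ k) ≋ (f +ₚ h) +ₚ (g +ₚ k)
  +ₚ-interchange f g h k = pointwise λ n → begin
    coeff ((f +ₚ g) +ₚ (h +ₚ k)) n                          ≡⟨ expand f g h k n ⟩
    (coeff f n + coeff g n) + (coeff h n + coeff k n)       ≡⟨ solve 4 (λ a b c d → (a :+ b) :+ (c :+ d) := (a :+ c) :+ (b :+ d)) refl (coeff f n) (coeff g n) (coeff h n) (coeff k n) ⟩
    (coeff f n + coeff h n) + (coeff g n + coeff k n)       ≡⟨ expand f h g k n ⟨
    coeff ((f +ₚ h) +ₚ (g +ₚ k)) n                          ∎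
    where
    open ≡-Reasoning
    open +-*-Solver
    expand : ∀ f g h k n → coeff ((f +ₚ g) +ₚ (h +ₚ k)) n ≡ (coeff f n + coeff g n) + (coeff h n + coeff k n)
    expand f g h k n = trans (coeff-+ₚ (f +ₚ g) (h +ₚ k) n) (cong₂ _+_ (coeff-+ₚ f g n) (coeff-+ₚ h k n))

  ≋-isEquivalence : IsEquivalence _≋_
  ≋-isEquivalence = record { refl = λ {f} → ≋-refl ; sym = ≋-sym ; trans = ≋-trans }

  ≋-setoid : Setoid 0ℓ 0ℓ
  ≋-setoid = record { isEquivalence = ≋-isEquivalence }

  module ≋-Reasoning = SetoidReasoning ≋-setoid

  *ₚ-congˡ : ∀ f {g g′} → g ≋ g′ → f *ₚ g ≋ f *ₚ g′
  *ₚ-congˡ []      g≋g′ = ≋-refl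
  *ₚ-congˡ (a ∷ f) {g} {g′} g≋g′ =
    +ₚ-cong (·ₚ-cong a g≋g′) (∷-cong refl (*ₚ-congˡ f g≋g′))

  *ₚ-zeroʳ : ∀ f → f *ₚ 0ₚ ≋ 0ₚ
  *ₚ-zeroʳ []      = ≋-refl
  *ₚ-zeroʳ (a ∷ f) = ≋-trans (∷-cong refl (*ₚ-zeroʳ f)) 0∷0ₚ

  -- The mirror image of the defining equation of `_*ₚ_`, which recurses on the left factor. It is
  -- what makes commutativity a plain induction.
  *ₚ-∷ʳ : ∀ f a g → f *ₚ (a ∷ g) ≋ a ·ₚ f +ₚ (0ℚ ∷ f *ₚ g)
  *ₚ-∷ʳ []      a g = ≋-sym 0∷0ₚ
  *ₚ-∷ʳ (b ∷ f) a g = ∷-cong (cong (_+ 0ℚ) (ℚ.*-comm b a)) (begin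
    b ·ₚ g +ₚ f *ₚ (a ∷ g)                ≈⟨ +ₚ-cong (≋-refl) (*ₚ-∷ʳ f a g) ⟩
    b ·ₚ g +ₚ (a ·ₚ f +ₚ (0ℚ ∷ f *ₚ g))   ≈⟨ +ₚ-assoc (b ·ₚ g) (a ·ₚ f) _ ⟨
    b ·ₚ g +ₚ a ·ₚ f +ₚ (0ℚ ∷ f *ₚ g)     ≈⟨ +ₚ-cong (+ₚ-comm (b ·ₚ g) (a ·ₚ f)) ≋-refl ⟩
    a ·ₚ f +ₚ b ·ₚ g +ₚ (0ℚ ∷ f *ₚ g)     ≈⟨ +ₚ-assoc (a ·ₚ f) (b ·ₚ g) _ ⟩
    a ·ₚ f +ₚ (b ·ₚ g +ₚ (0ℚ ∷ f *ₚ g))   ∎)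
    where open ≋-Reasoning

  *ₚ-comm : ∀ f g → f *ₚ g ≋ g *ₚ f
  *ₚ-comm []      g = ≋-sym (*ₚ-zeroʳ g)
  *ₚ-comm (a ∷ f) g = ≋-trans
    (+ₚ-cong (≋-refl) (∷-cong refl (*ₚ-comm f g)))
    (≋-sym (*ₚ-∷ʳ g a f))

  -- Lists related by `_≋_` may differ in length, so the left factor offers no direct induction;
  -- commutativity moves it to the right.
  *ₚ-cong : ∀ {f f′ g g′} → f ≋ f′ → g ≋ g′ → f *ₚ g ≋ f′ *ₚ g′
  *ₚ-cong {f} {f′} {g} {g′} f≋f′ g≋g′ = begin
    f *ₚ g    ≈⟨ *ₚ-congˡ f g≋g′ ⟩
    f *ₚ g′   ≈⟨ *ₚ-comm f g′ ⟩
    g′ *ₚ f   ≈⟨ *ₚ-congˡ g′ f≋f′ ⟩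
    g′ *ₚ f′  ≈⟨ *ₚ-comm g′ f′ ⟩
    f′ *ₚ g′  ∎
    where open ≋-Reasoning

  *ₚ-distribˡ : ∀ f g h → f *ₚ (g +ₚ h) ≋ f *ₚ g +ₚ f *ₚ h
  *ₚ-distribˡ []      g h = ≋-refl
  *ₚ-distribˡ (a ∷ f) g h = begin
    a ·ₚ (g +ₚ h) +ₚ (0ℚ ∷ f *ₚ (g +ₚ h))                     ≈⟨ +ₚ-cong (·ₚ-distrib-+ₚ a g h) (∷-cong refl (*ₚ-distribˡ f g h)) ⟩
    (a ·ₚ g +ₚ a ·ₚ h) +ₚ ((0ℚ ∷ f *ₚ g) +ₚ (0ℚ ∷ f *ₚ h))    ≈⟨ +ₚ-interchange (a ·ₚ g) (a ·ₚ h) (0ℚ ∷ f *ₚ g) (0ℚ ∷ f *ₚ h) ⟩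
    (a ·ₚ g +ₚ (0ℚ ∷ f *ₚ g)) +ₚ (a ·ₚ h +ₚ (0ℚ ∷ f *ₚ h))    ∎
    where open ≋-Reasoning

  *ₚ-distribʳ : ∀ f g h → (g +ₚ h) *ₚ f ≋ g *ₚ f +ₚ h *ₚ f
  *ₚ-distribʳ f g h = begin
    (g +ₚ h) *ₚ f       ≈⟨ *ₚ-comm (g +ₚ h) f ⟩
    f *ₚ (g +ₚ h)       ≈⟨ *ₚ-distribˡ f g h ⟩
    f *ₚ g +ₚ f *ₚ h    ≈⟨ +ₚ-cong (*ₚ-comm f g) (*ₚ-comm f h) ⟩
    g *ₚ f +ₚ h *ₚ f    ∎
    where open ≋-Reasoning

  ·ₚ-*ₚ : ∀ c f g → (c ·ₚ f) *ₚ g ≋ c ·ₚ (f *ₚ g)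
  ·ₚ-*ₚ c []      g = ≋-refl
  ·ₚ-*ₚ c (a ∷ f) g = begin
    (c * a) ·ₚ g +ₚ (0ℚ ∷ (c ·ₚ f) *ₚ g)         ≈⟨ +ₚ-cong (·ₚ-assoc c a g) (∷-cong (sym (ℚ.*-zeroʳ c)) (·ₚ-*ₚ c f g)) ⟩
    c ·ₚ (a ·ₚ g) +ₚ c ·ₚ (0ℚ ∷ f *ₚ g)          ≈⟨ ·ₚ-distrib-+ₚ c (a ·ₚ g) (0ℚ ∷ f *ₚ g) ⟨
    c ·ₚ (a ·ₚ g +ₚ (0ℚ ∷ f *ₚ g))               ∎
    where open ≋-Reasoning

  0∷-*ₚ : ∀ f g → (0ℚ ∷ f) *ₚ g ≋ 0ℚ ∷ f *ₚ g
  0∷-*ₚ f g = +ₚ-cong (0·ₚ g) ≋-refl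

  *ₚ-assoc : ∀ f g h → (f *ₚ g) *ₚ h ≋ f *ₚ (g *ₚ h)
  *ₚ-assoc []      g h = ≋-refl
  *ₚ-assoc (a ∷ f) g h = begin
    (a ·ₚ g +ₚ (0ℚ ∷ f *ₚ g)) *ₚ h              ≈⟨ *ₚ-distribʳ h (a ·ₚ g) (0ℚ ∷ f *ₚ g) ⟩
    (a ·ₚ g) *ₚ h +ₚ (0ℚ ∷ f *ₚ g) *ₚ h         ≈⟨ +ₚ-cong (·ₚ-*ₚ a g h) (0∷-*ₚ (f *ₚ g) h) ⟩
    a ·ₚ (g *ₚ h) +ₚ (0ℚ ∷ (f *ₚ g) *ₚ h)       ≈⟨ +ₚ-cong ≋-refl (∷-cong refl (*ₚ-assoc f g h)) ⟩
    a ·ₚ (g *ₚ h) +ₚ (0ℚ ∷ f *ₚ (g *ₚ h))       ∎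
    where open ≋-Reasoning

  constₚ-*ₚ : ∀ c f → constₚ c *ₚ f ≋ c ·ₚ f
  constₚ-*ₚ c f = ≋-trans (+ₚ-cong ≋-refl 0∷0ₚ) (+ₚ-identityʳ (c ·ₚ f))

  *ₚ-identityˡ : ∀ f → 1ₚ *ₚ f ≋ f
  *ₚ-identityˡ f = ≋-trans (constₚ-*ₚ 1ℚ f) (1·ₚ f)

  +ₚ-*ₚ-isCommutativeRing : IsCommutativeRing _≋_ _+ₚ_ _*ₚ_ -ₚ_ 0ₚ 1ₚ
  +ₚ-*ₚ-isCommutativeRing = record
    { isRing = record
      { +-isAbelianGroup = record
        { isGroup = record
          { isMonoid = record
            { isSemigroup = record
              { isMagma = record { isEquivalence = ≋-isEquivalence ; ∙-cong = +ₚ-cong }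
              ; assoc = +ₚ-assoc }
            ; identity = (λ f → ≋-refl) , +ₚ-identityʳ }
          ; inverse = (λ f → ≋-trans (+ₚ-comm (-ₚ f) f) (-ₚ-inverseʳ f)) , -ₚ-inverseʳ
          ; ⁻¹-cong = -ₚ-cong }
        ; comm = +ₚ-comm }
      ; *-cong = *ₚ-cong
      ; *-assoc = *ₚ-assoc
      ; *-identity = *ₚ-identityˡ , λ f → ≋-trans (*ₚ-comm f 1ₚ) (*ₚ-identityˡ f)
      ; distrib = *ₚ-distribˡ , *ₚ-distribʳ }
    ; *-comm = *ₚ-comm }

  ℚ[X] : ℚ-Algebra
  ℚ[X] = record
    { commutativeRing = record { isCommutativeRing = +ₚ-*ₚ-isCommutativeRing }
    ; ι     = constₚ
    ; ι-+   = λ p q → ≋-refl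
    ; ι-*   = λ p q → ∷-cong (sym (ℚ.+-identityʳ (p * q))) ≋-refl
    ; ι-neg = λ p → ≋-refl
    ; ι-0   = 0∷0ₚ
    ; ι-1   = ≋-refl }

open PolynomialRing
open _≋_

-- The field of rational functions

-- The field laws for fractions, cross-multiplied. Numerators and denominators are opaque elements
-- of an arbitrary algebra here, so no coefficient list unfolds.
module FractionIdentities (𝔸 : ℚ-Algebra) where
  open ℚ-Algebra 𝔸
  open Solver
  open SetoidReasoning setoid

  -- Cross-multiplied equalities compose only up to the middle denominator, which is nonzero and is
  -- cancelled afterwards by `*ₚ-cancelˡ`.
  trans-scaled : ∀ {a a′ b b′ c c′} → a * b′ ~ b * a′ → b * c′ ~ c * b′ → b′ * (a * c′) ~ b′ * (c * a′)
  trans-scaled {a} {a′} {b} {b′} {c} {c′} p q = begin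
    b′ * (a * c′)   ≈⟨ solve 3 (λ a b′ c′ → b′ :* (a :* c′) := (a :* b′) :* c′) ≈-refl a b′ c′ ⟩
    (a * b′) * c′   ≈⟨ *-congʳ p ⟩
    (b * a′) * c′   ≈⟨ solve 3 (λ a′ b c′ → (b :* a′) :* c′ := (b :* c′) :* a′) ≈-refl a′ b c′ ⟩
    (b * c′) * a′   ≈⟨ *-congʳ q ⟩
    (c * b′) * a′   ≈⟨ solve 3 (λ a′ b′ c → (c :* b′) :* a′ := b′ :* (c :* a′)) ≈-refl a′ b′ c ⟩
    b′ * (c * a′)   ∎

  add-cong : ∀ {a a′ b b′ c c′ d d′} → a * b′ ~ b * a′ → c * d′ ~ d * c′ →
             (a * c′ + c * a′) * (b′ * d′) ~ (b * d′ + d * b′) * (a′ * c′)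
  add-cong {a} {a′} {b} {b′} {c} {c′} {d} {d′} p q = begin
    (a * c′ + c * a′) * (b′ * d′)                  ≈⟨ solve 6 (λ a a′ b′ c c′ d′ → (a :* c′ :+ c :* a′) :* (b′ :* d′) := (a :* b′) :* (c′ :* d′) :+ (c :* d′) :* (a′ :* b′)) ≈-refl a a′ b′ c c′ d′ ⟩
    (a * b′) * (c′ * d′) + (c * d′) * (a′ * b′)    ≈⟨ +-cong (*-congʳ p) (*-congʳ q) ⟩
    (b * a′) * (c′ * d′) + (d * c′) * (a′ * b′)    ≈⟨ solve 6 (λ a′ b b′ c′ d d′ → (b :* a′) :* (c′ :* d′) :+ (d :* c′) :* (a′ :* b′) := (b :* d′ :+ d :* b′) :* (a′ :* c′)) ≈-refl a′ b b′ c′ d d′ ⟩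
    (b * d′ + d * b′) * (a′ * c′)                  ∎

  mul-cong : ∀ {a a′ b b′ c c′ d d′} → a * b′ ~ b * a′ → c * d′ ~ d * c′ →
             (a * c) * (b′ * d′) ~ (b * d) * (a′ * c′)
  mul-cong {a} {a′} {b} {b′} {c} {c′} {d} {d′} p q = begin
    (a * c) * (b′ * d′)   ≈⟨ interchange a c b′ d′ ⟩
    (a * b′) * (c * d′)   ≈⟨ *-cong p q ⟩
    (b * a′) * (d * c′)   ≈⟨ interchange b a′ d c′ ⟩
    (b * d) * (a′ * c′)   ∎
    where
    interchange : ∀ x y z w → (x * y) * (z * w) ~ (x * z) * (y * w)
    interchange = solve 4 (λ x y z w → (x :* y) :* (z :* w) := (x :* z) :* (y :* w)) ≈-refl

  neg-cong : ∀ {a a′ b b′} → a * b′ ~ b * a′ → (- a) * b′ ~ (- b) * a′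
  neg-cong {a} {a′} {b} {b′} p = begin
    (- a) * b′   ≈⟨ solve 2 (λ a b → (:- a) :* b := :- (a :* b)) ≈-refl a b′ ⟩
    - (a * b′)   ≈⟨ -‿cong p ⟩
    - (b * a′)   ≈⟨ solve 2 (λ a b → (:- a) :* b := :- (a :* b)) ≈-refl b a′ ⟨
    (- b) * a′   ∎

  add-assoc : ∀ a a′ b b′ c c′ → ((a * b′ + b * a′) * c′ + c * (a′ * b′)) * (a′ * (b′ * c′))
                               ~ (a * (b′ * c′) + (b * c′ + c * b′) * a′) * ((a′ * b′) * c′)
  add-assoc = solve 6 (λ a a′ b b′ c c′ →
    ((a :* b′ :+ b :* a′) :* c′ :+ c :* (a′ :* b′)) :* (a′ :* (b′ :* c′))
    := (a :* (b′ :* c′) :+ (b :* c′ :+ c :* b′) :* a′) :* ((a′ :* b′) :* c′)) ≈-refl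

  add-comm : ∀ a a′ b b′ → (a * b′ + b * a′) * (b′ * a′) ~ (b * a′ + a * b′) * (a′ * b′)
  add-comm = solve 4 (λ a a′ b b′ →
    (a :* b′ :+ b :* a′) :* (b′ :* a′) := (b :* a′ :+ a :* b′) :* (a′ :* b′)) ≈-refl

  add-zeroˡ : ∀ a a′ → (ι 0ℚ * a′ + a * ι 1ℚ) * a′ ~ a * (ι 1ℚ * a′)
  add-zeroˡ = solve 2 (λ a a′ → (con 0ℚ :* a′ :+ a :* con 1ℚ) :* a′ := a :* (con 1ℚ :* a′)) ≈-refl

  add-negʳ : ∀ a a′ → (a * a′ + (- a) * a′) * ι 1ℚ ~ ι 0ℚ * (a′ * a′)
  add-negʳ = solve 2 (λ a a′ → (a :* a′ :+ (:- a) :* a′) :* con 1ℚ := con 0ℚ :* (a′ :* a′)) ≈-refl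

  mul-assoc : ∀ a a′ b b′ c c′ → ((a * b) * c) * (a′ * (b′ * c′)) ~ (a * (b * c)) * ((a′ * b′) * c′)
  mul-assoc = solve 6 (λ a a′ b b′ c c′ →
    ((a :* b) :* c) :* (a′ :* (b′ :* c′)) := (a :* (b :* c)) :* ((a′ :* b′) :* c′)) ≈-refl

  mul-comm : ∀ a a′ b b′ → (a * b) * (b′ * a′) ~ (b * a) * (a′ * b′)
  mul-comm = solve 4 (λ a a′ b b′ → (a :* b) :* (b′ :* a′) := (b :* a) :* (a′ :* b′)) ≈-refl

  mul-oneˡ : ∀ a a′ → (ι 1ℚ * a) * a′ ~ a * (ι 1ℚ * a′)
  mul-oneˡ = solve 2 (λ a a′ → (con 1ℚ :* a) :* a′ := a :* (con 1ℚ :* a′)) ≈-refl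

  mul-distribˡ : ∀ a a′ b b′ c c′ → (a * (b * c′ + c * b′)) * ((a′ * b′) * (a′ * c′))
                                  ~ ((a * b) * (a′ * c′) + (a * c) * (a′ * b′)) * (a′ * (b′ * c′))
  mul-distribˡ = solve 6 (λ a a′ b b′ c c′ →
    (a :* (b :* c′ :+ c :* b′)) :* ((a′ :* b′) :* (a′ :* c′))
    := ((a :* b) :* (a′ :* c′) :+ (a :* c) :* (a′ :* b′)) :* (a′ :* (b′ :* c′))) ≈-refl

  const-add : ∀ p q → ι (p ℚ.+ q) * (ι 1ℚ * ι 1ℚ) ~ (ι p * ι 1ℚ + ι q * ι 1ℚ) * ι 1ℚ
  const-add p q = ≈-trans (*-congʳ (ι-+ p q))
    (solve 2 (λ x y → (x :+ y) :* (con 1ℚ :* con 1ℚ) := (x :* con 1ℚ :+ y :* con 1ℚ) :* con 1ℚ) ≈-refl (ι p) (ι q))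

  const-mul : ∀ p q → ι (p ℚ.* q) * (ι 1ℚ * ι 1ℚ) ~ (ι p * ι q) * ι 1ℚ
  const-mul p q = ≈-trans (*-congʳ (ι-* p q))
    (solve 2 (λ x y → (x :* y) :* (con 1ℚ :* con 1ℚ) := (x :* y) :* con 1ℚ) ≈-refl (ι p) (ι q))

  sub-zero : ∀ {a b c} → c * a ~ c * b → c * (a - b) ~ 0#
  sub-zero {a} {b} {c} p = begin
    c * (a - b)     ≈⟨ solve 3 (λ a b c → c :* (a :- b) := c :* a :- c :* b) ≈-refl a b c ⟩
    c * a - c * b   ≈⟨ +-congʳ p ⟩
    c * b - c * b   ≈⟨ -‿inverseʳ (c * b) ⟩
    0#              ∎

  zero-sub : ∀ {a b} → a - b ~ 0# → a ~ b
  zero-sub {a} {b} p = begin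
    a           ≈⟨ solve 2 (λ a b → a := (a :- b) :+ b) ≈-refl a b ⟩
    a - b + b   ≈⟨ +-congʳ p ⟩
    0# + b      ≈⟨ +-identityˡ b ⟩
    b           ∎

  zero-num : ∀ {a} a′ → a ~ 0# → a * ι 1ℚ ~ ι 0ℚ * a′
  zero-num {a} a′ p = begin
    a * ι 1ℚ    ≈⟨ *-congʳ p ⟩
    0# * ι 1ℚ   ≈⟨ zeroˡ (ι 1ℚ) ⟩
    0#          ≈⟨ zeroˡ a′ ⟨
    0# * a′     ≈⟨ *-congʳ ι-0 ⟨
    ι 0ℚ * a′   ∎

  mul-recip : ∀ a a′ → (a * a′) * ι 1ℚ ~ ι 1ℚ * (a′ * a)
  mul-recip = solve 2 (λ a a′ → (a :* a′) :* con 1ℚ := con 1ℚ :* (a′ :* a)) ≈-refl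

module Fr = FractionIdentities ℚ[X]

*ₚ-cancelˡ : ∀ {f g h} → ¬ (h ≈ₚ 0ₚ) → h *ₚ f ≋ h *ₚ g → f ≋ g
*ₚ-cancelˡ {f} {g} {h} h≉0 hf≋hg =
  [ (λ h≈0 → contradiction h≈0 h≉0) , (λ f-g≈0 → Fr.zero-sub (pointwise f-g≈0)) ]′
    (*ₚ-zero-product h (f +ₚ -ₚ g) (at (Fr.sub-zero {f} {g} {h} hf≋hg)))

infix 4 _≃_ _≄_
-- Like `_≋_`, a wrapper from which unification can recover the two sides.
record _≃_ (r s : RatFun) : Set where
  constructor crossMultiplied
  field
    cross : num r *ₚ den s ≋ num s *ₚ den r

open _≃_

_≄_ : RatFun → RatFun → Set
r ≄ s = ¬ (r ≃ s)

≃⇒≈ : ∀ {r s} → r ≃ s → r ≈ s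
≃⇒≈ r≃s = at (cross r≃s)

≈⇒≃ : ∀ {r s} → r ≈ s → r ≃ s
≈⇒≃ r≈s = crossMultiplied (pointwise r≈s)

≃-isEquivalence : IsEquivalence _≃_
≃-isEquivalence = record
  { refl  = crossMultiplied ≋-refl
  ; sym   = λ r≃s → crossMultiplied (≋-sym (cross r≃s))
  ; trans = λ {r} {s} {t} r≃s s≃t → crossMultiplied (*ₚ-cancelˡ {h = den s} (den≉0 s)
              (Fr.trans-scaled {num r} {den r} {num s} {den s} {num t} {den t} (cross r≃s) (cross s≃t))) }

ᵣ-isCommutativeRing : IsCommutativeRing _≃_ _+ᵣ_ _*ᵣ_ -ᵣ_ (const 0ℚ) (const 1ℚ)
ᵣ-isCommutativeRing = record
  { isRing = record
    { +-isAbelianGroup = record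
      { isGroup = record
        { isMonoid = record
          { isSemigroup = record
            { isMagma = record
              { isEquivalence = ≃-isEquivalence
              ; ∙-cong = λ {r} {r′} {s} {s′} r≃r′ s≃s′ → crossMultiplied
                  (Fr.add-cong {num r} {den r} {num r′} {den r′} {num s} {den s} {num s′} {den s′} (cross r≃r′) (cross s≃s′)) }
            ; assoc = λ r s t → crossMultiplied (Fr.add-assoc (num r) (den r) (num s) (den s) (num t) (den t)) }
          ; identity = add-zeroˡ , λ r → ≃-trans (add-comm r (const 0ℚ)) (add-zeroˡ r) }
        ; inverse = (λ r → ≃-trans (add-comm (-ᵣ r) r) (add-negʳ r)) , add-negʳ
        ; ⁻¹-cong = λ {r} {s} r≃s → crossMultiplied (Fr.neg-cong {num r} {den r} {num s} {den s} (cross r≃s)) }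
      ; comm = add-comm }
    ; *-cong = mul-cong
    ; *-assoc = λ r s t → crossMultiplied (Fr.mul-assoc (num r) (den r) (num s) (den s) (num t) (den t))
    ; *-identity = mul-oneˡ , λ r → ≃-trans (mul-comm r (const 1ℚ)) (mul-oneˡ r)
    ; distrib = mul-distribˡ , λ r s t → ≃-trans (mul-comm (s +ᵣ t) r) (≃-trans (mul-distribˡ r s t)
        (crossMultiplied (Fr.add-cong {num (r *ᵣ s)} {den (r *ᵣ s)} {num (s *ᵣ r)} {den (s *ᵣ r)} {num (r *ᵣ t)} {den (r *ᵣ t)} {num (t *ᵣ r)} {den (t *ᵣ r)}
          (cross (mul-comm r s)) (cross (mul-comm r t))))) }
  ; *-comm = mul-comm }
  where
  open IsEquivalence ≃-isEquivalence renaming (trans to ≃-trans)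
  add-comm : ∀ r s → r +ᵣ s ≃ s +ᵣ r
  add-comm r s = crossMultiplied (Fr.add-comm (num r) (den r) (num s) (den s))
  add-zeroˡ : ∀ r → const 0ℚ +ᵣ r ≃ r
  add-zeroˡ r = crossMultiplied (Fr.add-zeroˡ (num r) (den r))
  add-negʳ : ∀ r → r -ᵣ r ≃ const 0ℚ
  add-negʳ r = crossMultiplied (Fr.add-negʳ (num r) (den r))
  mul-comm : ∀ r s → r *ᵣ s ≃ s *ᵣ r
  mul-comm r s = crossMultiplied (Fr.mul-comm (num r) (den r) (num s) (den s))
  mul-oneˡ : ∀ r → const 1ℚ *ᵣ r ≃ r
  mul-oneˡ r = crossMultiplied (Fr.mul-oneˡ (num r) (den r))
  mul-distribˡ : ∀ r s t → r *ᵣ (s +ᵣ t) ≃ r *ᵣ s +ᵣ r *ᵣ t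
  mul-distribˡ r s t = crossMultiplied (Fr.mul-distribˡ (num r) (den r) (num s) (den s) (num t) (den t))
  mul-cong : ∀ {r r′ s s′} → r ≃ r′ → s ≃ s′ → r *ᵣ s ≃ r′ *ᵣ s′
  mul-cong {r} {r′} {s} {s′} r≃r′ s≃s′ = crossMultiplied
    (Fr.mul-cong {num r} {den r} {num r′} {den r′} {num s} {den s} {num s′} {den s′} (cross r≃r′) (cross s≃s′))

ℚ⟨X⟩ : ℚ-Algebra
ℚ⟨X⟩ = record
  { commutativeRing = record { isCommutativeRing = ᵣ-isCommutativeRing }
  ; ι     = const
  ; ι-+   = λ p q → crossMultiplied (Fr.const-add p q)
  ; ι-*   = λ p q → crossMultiplied (Fr.const-mul p q)
  ; ι-neg = λ p → crossMultiplied ≋-refl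
  ; ι-0   = crossMultiplied ≋-refl
  ; ι-1   = crossMultiplied ≋-refl }

-- Residues

2ℚ 3ℚ 4ℚ 6ℚ 8ℚ ¼ ⅛ : ℚ
2ℚ = ℤ.+ 2 ℚ./ 1
3ℚ = ℤ.+ 3 ℚ./ 1
4ℚ = ℤ.+ 4 ℚ./ 1
6ℚ = ℤ.+ 6 ℚ./ 1
8ℚ = ℤ.+ 8 ℚ./ 1
¼ = ℤ.+ 1 ℚ./ 4
⅛ = ℤ.+ 1 ℚ./ 8

ℚ-recip : ∀ q → q ≢ 0ℚ → ∃ λ p → q ℚ.* p ≡ 1ℚ
ℚ-recip q q≢0 = (ℚ.1/ q) , ℚ.*-inverseʳ q
  where instance _ = ℚ.≢-nonZero q≢0

ℚ-*-nonzero : ∀ {p q} → p ≢ 0ℚ → q ≢ 0ℚ → p ℚ.* q ≢ 0ℚ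
ℚ-*-nonzero p≢0 q≢0 pq≡0 = q≢0 (*-zero-product p≢0 pq≡0)

ℚ-unit-nonzero : ∀ {p q} → p ℚ.* q ≡ 1ℚ → p ≢ 0ℚ
ℚ-unit-nonzero {q = q} pq≡1 refl = contradiction (trans (sym (ℚ.*-zeroˡ q)) pq≡1) λ ()

-- A field over ℚ with a ℚ-rational place: x ⇝ q says that x is regular there
-- with residue q.
record PlacedField : Set₁ where
  field
    algebra : ℚ-Algebra
  open ℚ-Algebra algebra public
  infix 4 _⇝_
  field
    _⁻¹      : Carrier → Carrier
    inverseʳ : ∀ {x} → x ≁ 𝟘 → x * x ⁻¹ ~ 𝟙
    _⇝_      : Carrier → ℚ → Set
    ⇝-resp   : ∀ {x y q} → x ~ y → x ⇝ q → y ⇝ q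
    ⇝-ι      : ∀ q → ι q ⇝ q
    ⇝-+      : ∀ {x y p q} → x ⇝ p → y ⇝ q → x + y ⇝ p ℚ.+ q
    ⇝-*      : ∀ {x y p q} → x ⇝ p → y ⇝ q → x * y ⇝ p ℚ.* q
    ⇝-neg    : ∀ {x p} → x ⇝ p → - x ⇝ ℚ.- p
    ⇝-recip  : ∀ {x y p q} → x ⇝ p → x * y ~ 𝟙 → p ℚ.* q ≡ 1ℚ → y ⇝ q
    ⇝-unique : ∀ {x p q} → x ⇝ p → x ⇝ q → p ≡ q
    u        : Carrier
    u≁0      : u ≁ 𝟘
    u⇝0      : u ⇝ 0ℚ

  ⇝-value : ∀ {x p q} → p ≡ q → x ⇝ p → x ⇝ q
  ⇝-value {x} = subst (x ⇝_)

  ⇝-- : ∀ {x y p q} → x ⇝ p → y ⇝ q → x - y ⇝ p ℚ.- q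
  ⇝-- x⇝p y⇝q = ⇝-+ x⇝p (⇝-neg y⇝q)

  ⇝⇒≁0 : ∀ {x p} → x ⇝ p → p ≢ 0ℚ → x ≁ 𝟘
  ⇝⇒≁0 x⇝p p≢0 x~0 = p≢0 (⇝-unique (⇝-resp x~0 x⇝p) (⇝-ι 0ℚ))

  unit⇒≁0 : ∀ {x y} → x * y ~ 𝟙 → x ≁ 𝟘
  unit⇒≁0 {x} {y} xy~1 x~0 = ⇝⇒≁0 (⇝-ι 1ℚ) (λ ())
    (modulo (- 𝟙) xy~1 (modulo y x~0
      (solve 2 (λ x y → con 1ℚ := con 0ℚ :+ (:- con 1ℚ) :* (x :* y :- con 1ℚ) :+ y :* (x :- con 0ℚ)) ≈-refl x y)))
    where open Solver

  *-≁0 : ∀ {x y} → x ≁ 𝟘 → y ≁ 𝟘 → x * y ≁ 𝟘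
  *-≁0 {x} {y} x≁0 y≁0 xy~0 = y≁0
    (modulo (- y) (inverseʳ x≁0) (modulo (x ⁻¹) xy~0
      (solve 3 (λ x x′ y → y := con 0ℚ :+ (:- y) :* (x :* x′ :- con 1ℚ) :+ x′ :* (x :* y :- con 0ℚ)) ≈-refl x (x ⁻¹) y)))
    where open Solver

  *≁0⇒≁0ˡ : ∀ {x y} → x * y ≁ 𝟘 → x ≁ 𝟘
  *≁0⇒≁0ˡ {x} {y} xy≁0 x~0 = xy≁0 (modulo y x~0
    (solve 2 (λ x y → x :* y := con 0ℚ :+ y :* (x :- con 0ℚ)) ≈-refl x y))
    where open Solver

  -- The way to reach residues of expressions built from elements with poles, which have no residue
  -- themselves: multiply by a `y` of nonzero residue that clears the poles, and divide the
  -- residues.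
  ⇝-quotient : ∀ {w x y p q c} → w * y ~ x → x ⇝ p → y ⇝ q → q ≢ 0ℚ → c ℚ.* q ≡ p → w ⇝ c
  ⇝-quotient {w} {x} {y} {p} {q} {c} wy~x x⇝p y⇝q q≢0 cq≡p = ⇝-resp
    (modulo (- y ⁻¹) wy~x (modulo w yy⁻¹~1
      (solve 4 (λ w x y y′ → x :* y′ := w :+ (:- y′) :* (w :* y :- x) :+ w :* (y :* y′ :- con 1ℚ)) ≈-refl w x y (y ⁻¹))))
    (⇝-value pq⁻¹≡c (⇝-* x⇝p (⇝-recip y⇝q yy⁻¹~1 qq⁻¹≡1)))
    where
    open Solver
    yy⁻¹~1 : y * y ⁻¹ ~ 𝟙
    yy⁻¹~1 = inverseʳ (⇝⇒≁0 y⇝q q≢0)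
    q⁻¹ : ℚ
    q⁻¹ = proj₁ (ℚ-recip q q≢0)
    qq⁻¹≡1 : q ℚ.* q⁻¹ ≡ 1ℚ
    qq⁻¹≡1 = proj₂ (ℚ-recip q q≢0)
    pq⁻¹≡c : p ℚ.* q⁻¹ ≡ c
    pq⁻¹≡c = begin
      p ℚ.* q⁻¹           ≡⟨ cong (ℚ._* q⁻¹) cq≡p ⟨
      c ℚ.* q ℚ.* q⁻¹     ≡⟨ ℚ.*-assoc c q q⁻¹ ⟩
      c ℚ.* (q ℚ.* q⁻¹)   ≡⟨ cong (c ℚ.*_) qq⁻¹≡1 ⟩
      c ℚ.* 1ℚ            ≡⟨ ℚ.*-identityʳ c ⟩
      c                   ∎
      where open ≡-Reasoning

coeff₀-*ₚ : ∀ f g → coeff (f *ₚ g) 0 ≡ coeff f 0 ℚ.* coeff g 0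
coeff₀-*ₚ []      g = sym (ℚ.*-zeroˡ (coeff g 0))
coeff₀-*ₚ (a ∷ f) g = begin
  coeff (a ·ₚ g +ₚ (0ℚ ∷ f *ₚ g)) 0   ≡⟨ coeff-+ₚ (a ·ₚ g) (0ℚ ∷ f *ₚ g) 0 ⟩
  coeff (a ·ₚ g) 0 ℚ.+ 0ℚ             ≡⟨ ℚ.+-identityʳ _ ⟩
  coeff (a ·ₚ g) 0                    ≡⟨ coeff-·ₚ a g 0 ⟩
  a ℚ.* coeff g 0                     ∎
  where open ≡-Reasoning

infix 4 _⟿_
-- Fractions need not be reduced, so numerator and denominator of `r` may both vanish at 0 although
-- `r` is regular there. Hence some equal fraction is asked to have a denominator that does not
-- vanish at 0.
record _⟿_ (r : RatFun) (q : ℚ) : Set where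
  constructor residue
  field
    {representative} : RatFun
    equal            : r ≃ representative
    regular          : coeff (den representative) 0 ≢ 0ℚ
    value            : coeff (num representative) 0 ≡ q ℚ.* coeff (den representative) 0

module _ where
  open import Data.Rational using (_+_; _*_; -_)
  open CommutativeRing (ℚ-Algebra.commutativeRing ℚ⟨X⟩)
    using (+-cong; *-cong; -‿cong) renaming (trans to ≃-trans; sym to ≃-sym; refl to ≃-refl)
  open +-*-Solver

  private
    regular-product : ∀ f g → coeff f 0 ≢ 0ℚ → coeff g 0 ≢ 0ℚ → coeff (f *ₚ g) 0 ≢ 0ℚ
    regular-product f g f₀≢0 g₀≢0 = subst (_≢ 0ℚ) (sym (coeff₀-*ₚ f g)) (ℚ-*-nonzero f₀≢0 g₀≢0)

  ⟿-+ : ∀ {r s p q} → r ⟿ p → s ⟿ q → r +ᵣ s ⟿ p + q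
  ⟿-+ {p = p} {q} (residue {r} r≃ dr≢0 nr≡) (residue {s} s≃ ds≢0 ns≡) =
    residue (+-cong r≃ s≃) (regular-product (den r) (den s) dr≢0 ds≢0) (begin
      coeff (num r *ₚ den s +ₚ num s *ₚ den r) 0
        ≡⟨ coeff-+ₚ (num r *ₚ den s) (num s *ₚ den r) 0 ⟩
      coeff (num r *ₚ den s) 0 + coeff (num s *ₚ den r) 0
        ≡⟨ cong₂ _+_ (coeff₀-*ₚ (num r) (den s)) (coeff₀-*ₚ (num s) (den r)) ⟩
      coeff (num r) 0 * coeff (den s) 0 + coeff (num s) 0 * coeff (den r) 0
        ≡⟨ cong₂ (λ a b → a * coeff (den s) 0 + b * coeff (den r) 0) nr≡ ns≡ ⟩
      p * coeff (den r) 0 * coeff (den s) 0 + q * coeff (den s) 0 * coeff (den r) 0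
        ≡⟨ solve 4 (λ p q a b → p :* a :* b :+ q :* b :* a := (p :+ q) :* (a :* b)) refl p q (coeff (den r) 0) (coeff (den s) 0) ⟩
      (p + q) * (coeff (den r) 0 * coeff (den s) 0)
        ≡⟨ cong ((p + q) *_) (coeff₀-*ₚ (den r) (den s)) ⟨
      (p + q) * coeff (den r *ₚ den s) 0 ∎)
    where open ≡-Reasoning

  ⟿-* : ∀ {r s p q} → r ⟿ p → s ⟿ q → r *ᵣ s ⟿ p * q
  ⟿-* {p = p} {q} (residue {r} r≃ dr≢0 nr≡) (residue {s} s≃ ds≢0 ns≡) =
    residue (*-cong r≃ s≃) (regular-product (den r) (den s) dr≢0 ds≢0) (begin
      coeff (num r *ₚ num s) 0
        ≡⟨ coeff₀-*ₚ (num r) (num s) ⟩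
      coeff (num r) 0 * coeff (num s) 0
        ≡⟨ cong₂ _*_ nr≡ ns≡ ⟩
      p * coeff (den r) 0 * (q * coeff (den s) 0)
        ≡⟨ solve 4 (λ p q a b → p :* a :* (q :* b) := p :* q :* (a :* b)) refl p q (coeff (den r) 0) (coeff (den s) 0) ⟩
      p * q * (coeff (den r) 0 * coeff (den s) 0)
        ≡⟨ cong (p * q *_) (coeff₀-*ₚ (den r) (den s)) ⟨
      p * q * coeff (den r *ₚ den s) 0 ∎)
    where open ≡-Reasoning

  ⟿-neg : ∀ {r p} → r ⟿ p → -ᵣ r ⟿ - p
  ⟿-neg {p = p} (residue {r} r≃ dr≢0 nr≡) = residue (-‿cong r≃) dr≢0
    (trans (coeff-neg (num r) 0) (trans (cong -_ nr≡) (ℚ.neg-distribˡ-* p (coeff (den r) 0))))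

  ⟿-const : ∀ q → const q ⟿ q
  ⟿-const q = residue ≃-refl (λ ()) (sym (ℚ.*-identityʳ q))

  ⟿-resp : ∀ {r s q} → r ≃ s → r ⟿ q → s ⟿ q
  ⟿-resp r≃s (residue r≃ dr≢0 nr≡) = residue (≃-trans (≃-sym r≃s) r≃) dr≢0 nr≡

  private
    ≃-at-0 : ∀ {r s} → r ≃ s → coeff (num r) 0 * coeff (den s) 0 ≡ coeff (num s) 0 * coeff (den r) 0
    ≃-at-0 {r} {s} r≃s = trans (sym (coeff₀-*ₚ (num r) (den s)))
      (trans (at (cross r≃s) 0) (coeff₀-*ₚ (num s) (den r)))

    *-cancelʳ : ∀ {p q r} → r ≢ 0ℚ → p * r ≡ q * r → p ≡ q
    *-cancelʳ {p} {q} {r} r≢0 pr≡qr = begin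
      p                ≡⟨ solve 2 (λ p q → p := (p :+ :- q) :+ q) refl p q ⟩
      (p + - q) + q    ≡⟨ cong (_+ q) (*-zero-product r≢0 (begin
        r * (p + - q)      ≡⟨ solve 3 (λ p q r → r :* (p :+ :- q) := p :* r :+ :- (q :* r)) refl p q r ⟩
        p * r + - (q * r)  ≡⟨ cong (_+ - (q * r)) pr≡qr ⟩
        q * r + - (q * r)  ≡⟨ ℚ.+-inverseʳ (q * r) ⟩
        0ℚ                 ∎)) ⟩
      0ℚ + q           ≡⟨ ℚ.+-identityˡ q ⟩
      q                ∎
      where open ≡-Reasoning

  ⟿-unique : ∀ {r p q} → r ⟿ p → r ⟿ q → p ≡ q
  ⟿-unique {p = p} {q} (residue {s} r≃s ds≢0 ns≡) (residue {t} r≃t dt≢0 nt≡) =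
    *-cancelʳ (ℚ-*-nonzero ds≢0 dt≢0) (begin
      p * (coeff (den s) 0 * coeff (den t) 0)   ≡⟨ ℚ.*-assoc p _ _ ⟨
      p * coeff (den s) 0 * coeff (den t) 0     ≡⟨ cong (_* coeff (den t) 0) ns≡ ⟨
      coeff (num s) 0 * coeff (den t) 0         ≡⟨ ≃-at-0 (≃-trans (≃-sym r≃s) r≃t) ⟩
      coeff (num t) 0 * coeff (den s) 0         ≡⟨ cong (_* coeff (den s) 0) nt≡ ⟩
      q * coeff (den t) 0 * coeff (den s) 0     ≡⟨ solve 3 (λ q a b → q :* b :* a := q :* (a :* b)) refl q (coeff (den s) 0) (coeff (den t) 0) ⟩
      q * (coeff (den s) 0 * coeff (den t) 0)   ∎)
    where open ≡-Reasoning

  *ᵣ-inverseʳ : ∀ {r} → r ≄ const 0ℚ → r *ᵣ inv r ≃ const 1ℚ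
  *ᵣ-inverseʳ {r} r≄0 with num r ≈ₚ? 0ₚ
  ... | yes num≈0 = contradiction (crossMultiplied (Fr.zero-num {num r} (den r) (pointwise num≈0))) r≄0
  ... | no  num≉0 = crossMultiplied (Fr.mul-recip (num r) (den r))

  ⟿-recip : ∀ {r s p q} → r ⟿ p → r *ᵣ s ≃ const 1ℚ → p * q ≡ 1ℚ → s ⟿ q
  ⟿-recip {r} {s} {p} {q} (residue {t} r≃t dt≢0 nt≡) rs≃1 pq≡1 = residue {representative = t⁻¹}
    (inverse-unique {t} {s} {t⁻¹} (≃-trans (*-cong (≃-sym r≃t) (≃-refl {s})) rs≃1) (crossMultiplied (Fr.mul-recip (num t) (den t))))
    nt≢0
    (begin
      coeff (den t) 0             ≡⟨ ℚ.*-identityˡ _ ⟨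
      1ℚ * coeff (den t) 0        ≡⟨ cong (_* coeff (den t) 0) pq≡1 ⟨
      p * q * coeff (den t) 0     ≡⟨ solve 3 (λ p q d → p :* q :* d := q :* (p :* d)) refl p q (coeff (den t) 0) ⟩
      q * (p * coeff (den t) 0)   ≡⟨ cong (q *_) nt≡ ⟨
      q * coeff (num t) 0         ∎)
    where
    open ≡-Reasoning
    open ℚ-Algebra ℚ⟨X⟩ using (inverse-unique)
    nt≢0 : coeff (num t) 0 ≢ 0ℚ
    nt≢0 = subst (_≢ 0ℚ) (sym nt≡) (ℚ-*-nonzero (ℚ-unit-nonzero {p} {q} pq≡1) dt≢0)
    t⁻¹ : RatFun
    t⁻¹ = mkRatFun (den t) (num t) λ num≈0 → nt≢0 (num≈0 0)

ℚ⟨X⟩-at-0 : PlacedField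
ℚ⟨X⟩-at-0 = record
  { algebra  = ℚ⟨X⟩
  ; _⁻¹      = inv
  ; inverseʳ = *ᵣ-inverseʳ
  ; _⇝_      = _⟿_
  ; ⇝-resp   = ⟿-resp
  ; ⇝-ι      = ⟿-const
  ; ⇝-+      = ⟿-+
  ; ⇝-*      = ⟿-*
  ; ⇝-neg    = ⟿-neg
  ; ⇝-recip  = ⟿-recip
  ; ⇝-unique = ⟿-unique
  ; u        = mkRatFun X 1ₚ 1ₚ≉0ₚ
  ; u≁0      = λ u≃0 → contradiction (at (cross u≃0) 1) λ ()
  ; u⇝0      = residue {representative = mkRatFun X 1ₚ 1ₚ≉0ₚ} (crossMultiplied ≋-refl) (λ ()) refl }

-- Torsion

module _ where
  open import Data.Rational using (_+_; _*_; -_; _-_; _<_)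
  open +-*-Solver

  ℚ-modulo : ∀ {x y a b} c → a ≡ b → x ≡ y + c * (a - b) → x ≡ y
  ℚ-modulo {y = y} {a} c refl x≡ = trans x≡ (solve 3 (λ y a c → y :+ c :* (a :- a) := y) refl y a c)

  -- The chord of the cuspidal cubic through (1 , 1) and (q² , q³) has slope (q² + q + 1) / (q + 1)
  -- = q + 1 - g with g = q / (1 + q). This and the next two identities show that the sum of the two
  -- points is (g² , g³).
  chord-slope : ∀ q g → g * (1ℚ + q) ≡ q → (q + 1ℚ - g) * (q * q - 1ℚ) ≡ q * q * q - 1ℚ
  chord-slope q g h = ℚ-modulo (1ℚ - q) h
    (solve 2 (λ q g → (q :+ con 1ℚ :- g) :* (q :* q :- con 1ℚ)
      := q :* q :* q :- con 1ℚ :+ (con 1ℚ :- q) :* (g :* (con 1ℚ :+ q) :- q)) refl q g)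

  chord-abscissa : ∀ q g → g * (1ℚ + q) ≡ q → (q + 1ℚ - g) * (q + 1ℚ - g) - 1ℚ - q * q ≡ g * g
  chord-abscissa q g h = ℚ-modulo (- 2ℚ) h
    (solve 2 (λ q g → (q :+ con 1ℚ :- g) :* (q :+ con 1ℚ :- g) :- con 1ℚ :- q :* q
      := g :* g :+ (:- con 2ℚ) :* (g :* (con 1ℚ :+ q) :- q)) refl q g)

  chord-ordinate : ∀ q g → g * (1ℚ + q) ≡ q → (q + 1ℚ - g) * (1ℚ - g * g) - 1ℚ ≡ g * g * g
  chord-ordinate q g h = ℚ-modulo (- (1ℚ + g)) h
    (solve 2 (λ q g → (q :+ con 1ℚ :- g) :* (con 1ℚ :- g :* g) :- con 1ℚ
      := g :* g :* g :+ (:- (con 1ℚ :+ g)) :* (g :* (con 1ℚ :+ q) :- q)) refl q g)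

  -- The multiple n P reduces to q = 1 / n. For n ≥ 2 this range is all that is retained of it: it
  -- keeps the abscissa q² apart from the abscissa 1 of P.
  Proper : ℚ → Set
  Proper q = 0ℚ < q × q < 1ℚ

  proper-square≢1 : ∀ {q} → Proper q → q * q - 1ℚ ≢ 0ℚ
  proper-square≢1 {q} (0<q , q<1) qq-1≡0 = ℚ.<-irrefl qq≡1 (ℚ.<-trans
    (subst (q * q <_) (ℚ.*-identityʳ q) (ℚ.*-monoʳ-<-pos q {{ℚ.positive 0<q}} q<1)) q<1)
    where
    qq≡1 : q * q ≡ 1ℚ
    qq≡1 = ℚ-modulo 1ℚ qq-1≡0 (solve 1 (λ x → x := con 1ℚ :+ con 1ℚ :* (x :- con 1ℚ :- con 0ℚ)) refl (q * q))

  -- In the additive parameter this is 1 / g = 1 / q + 1, the effect of adding P once more.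
  next-proper : ∀ {q} → Proper q → ∃ λ g → Proper g × g * (1ℚ + q) ≡ q
  next-proper {q} (0<q , q<1) = g , (0<g , ℚ.<-trans g<q q<1) , g[1+q]≡q
    where
    instance
      q-pos : ℚ.Positive q
      q-pos = ℚ.positive 0<q
      1+q-pos : ℚ.Positive (1ℚ + q)
      1+q-pos = ℚ.pos+pos⇒pos 1ℚ q
      1+q-nonZero : ℚ.NonZero (1ℚ + q)
      1+q-nonZero = ℚ.pos⇒nonZero (1ℚ + q)
      recip-pos : ℚ.Positive (ℚ.1/ (1ℚ + q))
      recip-pos = ℚ.1/pos⇒pos (1ℚ + q)
    g : ℚ
    g = q * ℚ.1/ (1ℚ + q)
    instance
      g-pos : ℚ.Positive g
      g-pos = ℚ.pos*pos⇒pos q (ℚ.1/ (1ℚ + q))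
    0<g : 0ℚ < g
    0<g = ℚ.positive⁻¹ g
    g[1+q]≡q : g * (1ℚ + q) ≡ q
    g[1+q]≡q = trans (ℚ.*-assoc q _ _) (trans (cong (q *_) (ℚ.*-inverseˡ (1ℚ + q))) (ℚ.*-identityʳ q))
    g<q : g < q
    g<q = subst (g <_) g[1+q]≡q (subst (_< g * (1ℚ + q)) (ℚ.*-identityʳ g)
      (ℚ.*-monoʳ-<-pos g (subst (_< 1ℚ + q) (ℚ.+-identityʳ 1ℚ) (ℚ.+-monoʳ-< 1ℚ 0<q))))

-- In the coordinates (x z² , y z³) the curve y² = x³ + A x has coefficient A z⁴.
-- If that coefficient vanishes at the place, the curve degenerates to the cuspidal
-- cubic y² = x³, whose smooth points (q² , q³) form the additive group with
-- parameter 1 / q.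
module CuspidalReduction (𝔽 : PlacedField) where
  open PlacedField 𝔽
  open Solver

  record Reduces (z x y : Carrier) (q : ℚ) : Set where
    constructor reduces
    field
      abscissa : x * (z * z) ⇝ q ℚ.* q
      ordinate : y * (z * z * z) ⇝ q ℚ.* q ℚ.* q

  open Reduces public

  third-abscissa : ∀ {z m x₁ x₂ c p₁ p₂} → m * z ⇝ c → x₁ * (z * z) ⇝ p₁ → x₂ * (z * z) ⇝ p₂ →
                   (m * m - x₁ - x₂) * (z * z) ⇝ c ℚ.* c ℚ.- p₁ ℚ.- p₂
  third-abscissa {z} {m} {x₁} {x₂} m⇝ x₁⇝ x₂⇝ = ⇝-resp
    (solve 4 (λ z m x₁ x₂ → (m :* z) :* (m :* z) :- x₁ :* (z :* z) :- x₂ :* (z :* z)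
                          := (m :* m :- x₁ :- x₂) :* (z :* z)) ≈-refl z m x₁ x₂)
    (⇝-- (⇝-- (⇝-* m⇝ m⇝) x₁⇝) x₂⇝)

  third-ordinate : ∀ {z m x₁ y₁ x₃ c p₁ p₃ r₁} → m * z ⇝ c → x₁ * (z * z) ⇝ p₁ →
                   y₁ * (z * z * z) ⇝ r₁ → x₃ * (z * z) ⇝ p₃ →
                   (m * (x₁ - x₃) - y₁) * (z * z * z) ⇝ c ℚ.* (p₁ ℚ.- p₃) ℚ.- r₁
  third-ordinate {z} {m} {x₁} {y₁} {x₃} m⇝ x₁⇝ y₁⇝ x₃⇝ = ⇝-resp
    (solve 5 (λ z m x₁ y₁ x₃ → (m :* z) :* (x₁ :* (z :* z) :- x₃ :* (z :* z)) :- y₁ :* (z :* z :* z)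
                            := (m :* (x₁ :- x₃) :- y₁) :* (z :* z :* z)) ≈-refl z m x₁ y₁ x₃)
    (⇝-- (⇝-* m⇝ (⇝-- x₁⇝ x₃⇝)) y₁⇝)

  difference-reduces : ∀ {z x₁ y₁ x₂ y₂ q} → Reduces z x₁ y₁ 1ℚ → Reduces z x₂ y₂ q →
                       (x₂ - x₁) * (z * z) ⇝ q ℚ.* q ℚ.- 1ℚ
  difference-reduces {z} {x₁} {x₂ = x₂} P₁ P₂ = ⇝-resp
    (solve 3 (λ z x₁ x₂ → x₂ :* (z :* z) :- x₁ :* (z :* z) := (x₂ :- x₁) :* (z :* z)) ≈-refl z x₁ x₂)
    (⇝-- (abscissa P₂) (abscissa P₁))

  difference≁0 : ∀ {z x₁ y₁ x₂ y₂ q} → Proper q → Reduces z x₁ y₁ 1ℚ → Reduces z x₂ y₂ q → x₂ - x₁ ≁ 𝟘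
  difference≁0 q-proper P₁ P₂ =
    *≁0⇒≁0ˡ (⇝⇒≁0 (difference-reduces P₁ P₂) (proper-square≢1 q-proper))

  chord : ∀ {z x₁ y₁ x₂ y₂ m q g} → Proper q → g ℚ.* (1ℚ ℚ.+ q) ≡ q →
          Reduces z x₁ y₁ 1ℚ → Reduces z x₂ y₂ q → m * (x₂ - x₁) ~ y₂ - y₁ →
          Reduces z (m * m - x₁ - x₂) (m * (x₁ - (m * m - x₁ - x₂)) - y₁) g
  chord {z} {x₁} {y₁} {x₂} {y₂} {m} {q} {g} q-proper h P₁ P₂ slope = reduces x₃⇝
    (⇝-value (chord-ordinate q g h) (third-ordinate mz⇝ (abscissa P₁) (ordinate P₁) x₃⇝))
    where
    mz⇝ : m * z ⇝ q ℚ.+ 1ℚ ℚ.- g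
    mz⇝ = ⇝-quotient
      (modulo (z * z * z) slope
        (solve 6 (λ z x₁ y₁ x₂ y₂ m → (m :* z) :* ((x₂ :- x₁) :* (z :* z))
          := (y₂ :* (z :* z :* z) :- y₁ :* (z :* z :* z)) :+ (z :* z :* z) :* (m :* (x₂ :- x₁) :- (y₂ :- y₁)))
          ≈-refl z x₁ y₁ x₂ y₂ m))
      (⇝-- (ordinate P₂) (ordinate P₁)) (difference-reduces P₁ P₂) (proper-square≢1 q-proper) (chord-slope q g h)
    x₃⇝ : (m * m - x₁ - x₂) * (z * z) ⇝ g ℚ.* g
    x₃⇝ = ⇝-value (chord-abscissa q g h) (third-abscissa mz⇝ (abscissa P₁) (abscissa P₂))

  double-ordinate : ∀ {z x₁ y₁} → Reduces z x₁ y₁ 1ℚ → (ι 2ℚ * y₁) * (z * z * z) ⇝ 2ℚ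
  double-ordinate {z} {y₁ = y₁} P₁ = ⇝-resp
    (solve 2 (λ z y₁ → con 2ℚ :* (y₁ :* (z :* z :* z)) := (con 2ℚ :* y₁) :* (z :* z :* z)) ≈-refl z y₁)
    (⇝-* (⇝-ι 2ℚ) (ordinate P₁))

  -- The coefficient `A` enters the rescaled slope only through A z⁴, which vanishes at the place.
  -- What remains is the tangent of the cuspidal cubic at (1 , 1), of slope 3 / 2, and the double (1
  -- / 4 , 1 / 8).
  tangent : ∀ {A z x₁ y₁ m} → A * (z * z * z * z) ⇝ 0ℚ →
            Reduces z x₁ y₁ 1ℚ → m * (ι 2ℚ * y₁) ~ ι 3ℚ * (x₁ * x₁) + A →
            Reduces z (m * m - x₁ - x₁) (m * (x₁ - (m * m - x₁ - x₁)) - y₁) ½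
  tangent {A} {z} {x₁} {y₁} {m} A⇝0 P₁ slope =
    reduces x₃⇝ (third-ordinate mz⇝ (abscissa P₁) (ordinate P₁) x₃⇝)
    where
    mz⇝ : m * z ⇝ 3ℚ ℚ.* ½
    mz⇝ = ⇝-quotient
      (modulo (z * z * z * z) slope
        (solve 5 (λ A z x₁ y₁ m → (m :* z) :* ((con 2ℚ :* y₁) :* (z :* z :* z))
          := (con 3ℚ :* ((x₁ :* (z :* z)) :* (x₁ :* (z :* z))) :+ A :* (z :* z :* z :* z))
             :+ (z :* z :* z :* z) :* (m :* (con 2ℚ :* y₁) :- (con 3ℚ :* (x₁ :* x₁) :+ A)))
          ≈-refl A z x₁ y₁ m))
      (⇝-+ (⇝-* (⇝-ι 3ℚ) (⇝-* (abscissa P₁) (abscissa P₁))) A⇝0) (double-ordinate P₁) (λ ()) refl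
    x₃⇝ : (m * m - x₁ - x₁) * (z * z) ⇝ ½ ℚ.* ½
    x₃⇝ = third-abscissa mz⇝ (abscissa P₁) (abscissa P₁)

  -- The rescaled ordinates have residues 1 and -1. This keeps the doubling of P out of the branch
  -- of `add` that returns `∞`.
  negated-ordinate : ∀ {z x y} → Reduces z x y 1ℚ → y ≁ - y
  negated-ordinate {z} {x} {y} P y~-y = contradiction (⇝-unique (ordinate P) (⇝-resp
    (modulo (- (z * z * z)) y~-y (solve 2 (λ z y → (:- (y :* (z :* z :* z)))
      := y :* (z :* z :* z) :+ (:- (z :* z :* z)) :* (y :- (:- y))) ≈-refl z y))
    (⇝-neg (ordinate P)))) λ ()

  quotient-slope : ∀ {x y} → y ≁ 𝟘 → (x * y ⁻¹) * y ~ x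
  quotient-slope {x} {y} y≁0 = modulo x (inverseʳ y≁0)
    (solve 3 (λ x y y′ → (x :* y′) :* y := x :+ x :* (y :* y′ :- con 1ℚ)) ≈-refl x y (y ⁻¹))

  difference-zero : ∀ {x y} → x ~ y → y - x ~ 𝟘
  difference-zero {x} {y} x~y = modulo (- 𝟙) x~y
    (solve 2 (λ x y → y :- x := con 0ℚ :+ (:- con 1ℚ) :* (x :- y)) ≈-refl x y)

-- Multiples of a point with cuspidal reduction

add-chord : ∀ A {x₁ y₁ x₂ y₂} → x₁ ≄ x₂ → add A (affine x₁ y₁) (affine x₂ y₂)
            ≡ thirdPoint ((y₂ -ᵣ y₁) ÷ᵣ (x₂ -ᵣ x₁)) x₁ y₁ x₂
add-chord A {x₁} {y₁} {x₂} {y₂} x₁≄x₂ with x₁ ≈? x₂ | y₁ ≈? (-ᵣ y₂)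
... | no  _     | _ = refl
... | yes x₁≈x₂ | _ = contradiction (≈⇒≃ {x₁} {x₂} x₁≈x₂) x₁≄x₂

add-tangent : ∀ A {x y} → y ≄ -ᵣ y → add A (affine x y) (affine x y)
              ≡ thirdPoint ((const 3ℚ *ᵣ (x *ᵣ x) +ᵣ A) ÷ᵣ (const 2ℚ *ᵣ y)) x y x
add-tangent A {x} {y} y≄-y with x ≈? x | y ≈? (-ᵣ y)
... | no  x≉x | _        = contradiction (≃⇒≈ {x} {x} (crossMultiplied ≋-refl)) x≉x
... | yes _   | no  _    = refl
... | yes _   | yes y≈-y = contradiction (≈⇒≃ {y} { -ᵣ y} y≈-y) y≄-y

module _ where
  open PlacedField ℚ⟨X⟩-at-0
  open CuspidalReduction ℚ⟨X⟩-at-0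

  -- The induction starts at 2 P, where q = 1 / 2, because P itself has q = 1 and its doubling needs
  -- the tangent. From then on q < 1 separates the abscissas q² and 1, so each further addition of P
  -- is a chord and gives an affine point.
  multiple-reduces : ∀ {A z x y} → A *ᵣ (z *ᵣ z *ᵣ z *ᵣ z) ⟿ 0ℚ → Reduces z x y 1ℚ → ∀ n →
    ∃₂ λ x′ y′ → ∃ λ q → multiple A (suc (suc n)) (affine x y) ≡ affine x′ y′ × Proper q × Reduces z x′ y′ q
  multiple-reduces {A} {z} {x} {y} A⟿0 P zero = _ , _ , ½ , add-tangent A (negated-ordinate P)
    , (from-yes (0ℚ ℚ.<? ½) , from-yes (½ ℚ.<? 1ℚ))
    , tangent {A} {m = (const 3ℚ *ᵣ (x *ᵣ x) +ᵣ A) ÷ᵣ (const 2ℚ *ᵣ y)} A⟿0 P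
        (quotient-slope {const 3ℚ *ᵣ (x *ᵣ x) +ᵣ A} {const 2ℚ *ᵣ y}
          (*≁0⇒≁0ˡ {y = z *ᵣ z *ᵣ z} (⇝⇒≁0 (double-ordinate P) λ ())))
  multiple-reduces {A} {z} {x} {y} A⟿0 P (suc n) =
    let x′ , y′ , q , multiple≡ , q-proper , P′ = multiple-reduces A⟿0 P n
        g , g-proper , h = next-proper q-proper
        x′-x≁0 = difference≁0 {z} {x} {y} {x′} {y′} q-proper P P′
    in _ , _ , g
       , trans (cong (add A (affine x y)) multiple≡) (add-chord A (λ x≃x′ → x′-x≁0 (difference-zero {x} {x′} x≃x′)))
       , g-proper
       , chord {m = (y′ -ᵣ y) ÷ᵣ (x′ -ᵣ x)} q-proper h P P′ (quotient-slope {y′ -ᵣ y} {x′ -ᵣ x} x′-x≁0)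

  reduces⇒nonTorsion : ∀ {A z x y} → A *ᵣ (z *ᵣ z *ᵣ z *ᵣ z) ⟿ 0ℚ → Reduces z x y 1ℚ → NonTorsion A (affine x y)
  reduces⇒nonTorsion A⟿0 P zero          _   = refl
  reduces⇒nonTorsion A⟿0 P (suc zero)    ()
  reduces⇒nonTorsion A⟿0 P (suc (suc n)) ≡∞ =
    let _ , _ , _ , multiple≡ , _ = multiple-reduces A⟿0 P n
    in contradiction (trans (sym multiple≡) ≡∞) λ ()

-- Sections whose reduction is cuspidal

module Sections (𝔽 : PlacedField) where
  open PlacedField 𝔽
  open Solver
  open CuspidalReduction 𝔽

  -- A point (x , y) of y² = x³ + f(φ) x at which f(φ) is negligible against x².
  record Section (f : Poly) : Set where
    field
      φ x y κ      : Carrier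
      non-constant : ∀ c → φ ≁ ι c
      on-curve     : y * y ~ x * x * x + evaluate f φ * x + 𝟘
      x≁0          : x ≁ 𝟘
      coefficient  : evaluate f φ ~ κ * (x * x)
      κ⇝0          : κ ⇝ 0ℚ

  module _ {A x y κ : Carrier} (on-curve : y * y ~ x * x * x + A * x + 𝟘) (x≁0 : x ≁ 𝟘)
           (coefficient : A ~ κ * (x * x)) (κ⇝0 : κ ⇝ 0ℚ) where

    1+κ⇝1 : 𝟙 + κ ⇝ 1ℚ
    1+κ⇝1 = ⇝-+ (⇝-ι 1ℚ) κ⇝0

    y² : y * y ~ (x * x * x) * (𝟙 + κ)
    y² = modulo 𝟙 on-curve (modulo x coefficient
      (solve 4 (λ A x y κ → y :* y := x :* x :* x :* (con 1ℚ :+ κ)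
        :+ con 1ℚ :* (y :* y :- (x :* x :* x :+ A :* x :+ con 0ℚ)) :+ x :* (A :- κ :* (x :* x))) ≈-refl A x y κ))

    y≁0 : y ≁ 𝟘
    y≁0 y~0 = *-≁0 (*-≁0 (*-≁0 x≁0 x≁0) x≁0) (⇝⇒≁0 1+κ⇝1 λ ())
      (modulo (- 𝟙) y² (modulo y y~0
        (solve 3 (λ x y κ → x :* x :* x :* (con 1ℚ :+ κ)
          := con 0ℚ :+ (:- con 1ℚ) :* (y :* y :- x :* x :* x :* (con 1ℚ :+ κ)) :+ y :* (y :- con 0ℚ)) ≈-refl x y κ)))

    -- The scaling that brings P to (1 , 1): since y² = x³ (1 + κ), both x z² and y z³ equal x³ / y²
    -- = 1 / (1 + κ), and A z⁴ = κ (x z²)² has residue 0.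
    z : Carrier
    z = x * y ⁻¹

    section-reduces : Reduces z x y 1ℚ
    section-reduces = reduces
      (⇝-quotient
        (modulo (- (y ⁻¹ * y ⁻¹)) y² (modulo (y * y ⁻¹ + 𝟙) (inverseʳ y≁0)
          (solve 4 (λ x y y′ κ → x :* ((x :* y′) :* (x :* y′)) :* (con 1ℚ :+ κ)
            := con 1ℚ :+ (:- (y′ :* y′)) :* (y :* y :- x :* x :* x :* (con 1ℚ :+ κ))
               :+ (y :* y′ :+ con 1ℚ) :* (y :* y′ :- con 1ℚ)) ≈-refl x y (y ⁻¹) κ)))
        (⇝-ι 1ℚ) 1+κ⇝1 (λ ()) refl)
      (⇝-quotient
        (modulo (- (y * (y ⁻¹ * y ⁻¹ * y ⁻¹))) y² (modulo (y * y ⁻¹ * (y * y ⁻¹) + y * y ⁻¹ + 𝟙) (inverseʳ y≁0)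
          (solve 4 (λ x y y′ κ → y :* ((x :* y′) :* (x :* y′) :* (x :* y′)) :* (con 1ℚ :+ κ)
            := con 1ℚ :+ (:- (y :* (y′ :* y′ :* y′))) :* (y :* y :- x :* x :* x :* (con 1ℚ :+ κ))
               :+ (y :* y′ :* (y :* y′) :+ y :* y′ :+ con 1ℚ) :* (y :* y′ :- con 1ℚ)) ≈-refl x y (y ⁻¹) κ)))
        (⇝-ι 1ℚ) 1+κ⇝1 (λ ()) refl)

    coefficient-reduces : A * (z * z * z * z) ⇝ 0ℚ
    coefficient-reduces = ⇝-resp
      (modulo (- (z * z * z * z)) coefficient
        (solve 4 (λ A x z κ → κ :* ((x :* (z :* z)) :* (x :* (z :* z)))
          := A :* (z :* z :* z :* z) :+ (:- (z :* z :* z :* z)) :* (A :- κ :* (x :* x))) ≈-refl A x z κ))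
      (⇝-* κ⇝0 (⇝-* (abscissa section-reduces) (abscissa section-reduces)))

-- Quartics

module _ where
  open import Data.Rational using (_+_; _*_; -_; _-_)
  open +-*-Solver

  -- The coefficients of a t⁴ + a₃ t³ + a₂ t² + a₁ t + a₀ = a ((s² + h)² + D s + E), s = t + β.
  record Depressed (a₀ a₁ a₂ a₃ a : ℚ) : Set where
    field
      β h D E : ℚ
      cubic     : a₃ ≡ a * (4ℚ * β)
      quadratic : a₂ ≡ a * (6ℚ * (β * β) + 2ℚ * h)
      linear    : a₁ ≡ a * (4ℚ * (β * (β * β)) + 4ℚ * (h * β) + D)
      constant  : a₀ ≡ a * ((β * β + h) * (β * β + h) + D * β + E)

  depress : ∀ a₀ a₁ a₂ a₃ {a} → a ≢ 0ℚ → Depressed a₀ a₁ a₂ a₃ a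
  depress a₀ a₁ a₂ a₃ {a} a≢0 = record
    { β = β ; h = h ; D = D ; E = E
    ; cubic     = ℚ-modulo (- a₃) ai≡1
        (solve 3 (λ a i a₃ → a₃ := a :* (con 4ℚ :* (a₃ :* i :* con ¼)) :+ (:- a₃) :* (a :* i :- con 1ℚ)) refl a i a₃)
    ; quadratic = ℚ-modulo (- a₂) ai≡1
        (solve 4 (λ a i a₂ β → a₂ := a :* (con 6ℚ :* (β :* β) :+ con 2ℚ :* ((a₂ :* i :- con 6ℚ :* (β :* β)) :* con ½))
           :+ (:- a₂) :* (a :* i :- con 1ℚ)) refl a i a₂ β)
    ; linear    = ℚ-modulo (- a₁) ai≡1
        (solve 5 (λ a i a₁ β h → a₁ := a :* (con 4ℚ :* (β :* (β :* β)) :+ con 4ℚ :* (h :* β)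
             :+ (a₁ :* i :- (con 4ℚ :* (β :* (β :* β)) :+ con 4ℚ :* (h :* β))))
           :+ (:- a₁) :* (a :* i :- con 1ℚ)) refl a i a₁ β h)
    ; constant  = ℚ-modulo (- a₀) ai≡1
        (solve 6 (λ a i a₀ β h D → a₀ := a :* ((β :* β :+ h) :* (β :* β :+ h) :+ D :* β
             :+ (a₀ :* i :- ((β :* β :+ h) :* (β :* β :+ h) :+ D :* β)))
           :+ (:- a₀) :* (a :* i :- con 1ℚ)) refl a i a₀ β h D) }
    where
    i : ℚ
    i = proj₁ (ℚ-recip a a≢0)
    ai≡1 : a * i ≡ 1ℚ
    ai≡1 = proj₂ (ℚ-recip a a≢0)
    β h D E : ℚ
    β = a₃ * i * ¼
    h = (a₂ * i - 6ℚ * (β * β)) * ½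
    D = a₁ * i - (4ℚ * (β * (β * β)) + 4ℚ * (h * β))
    E = a₀ * i - ((β * β + h) * (β * β + h) + D * β)

  -- Up to a constant, the value at ∞ of the sextic covariant of the quartic.
  covariant : ∀ {a₀ a₁ a₂ a₃ a} (d : Depressed a₀ a₁ a₂ a₃ a) →
              Depressed.D d * (a * (a * a)) ≡ a₁ * (a * a) - ½ * (a₂ * (a₃ * a)) + ⅛ * (a₃ * (a₃ * a₃))
  covariant {a = a} record { β = β ; h = h ; D = D ; cubic = refl ; quadratic = refl ; linear = refl } =
    solve 4 (λ a β h D → let a₁ = a :* (con 4ℚ :* (β :* (β :* β)) :+ con 4ℚ :* (h :* β) :+ D)
                             a₂ = a :* (con 6ℚ :* (β :* β) :+ con 2ℚ :* h)
                             a₃ = a :* (con 4ℚ :* β) in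
      D :* (a :* (a :* a)) := a₁ :* (a :* a) :- con ½ :* (a₂ :* (a₃ :* a)) :+ con ⅛ :* (a₃ :* (a₃ :* a₃)))
      refl a β h D

module QuarticEvaluation (𝔸 : ℚ-Algebra) where
  open ℚ-Algebra 𝔸
  open Solver

  horner₄ : (a₀ a₁ a₂ a₃ a : ℚ) → Carrier → Carrier
  horner₄ a₀ a₁ a₂ a₃ a x = ι a₀ + x * (ι a₁ + x * (ι a₂ + x * (ι a₃ + x * ι a)))

  evaluate-quartic : ∀ f x → HasDegree f 4 →
                     evaluate f x ~ horner₄ (coeff f 0) (coeff f 1) (coeff f 2) (coeff f 3) (coeff f 4) x
  evaluate-quartic []                        x (a≢0 , _) = contradiction refl a≢0
  evaluate-quartic (_ ∷ [])                  x (a≢0 , _) = contradiction refl a≢0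
  evaluate-quartic (_ ∷ _ ∷ [])              x (a≢0 , _) = contradiction refl a≢0
  evaluate-quartic (_ ∷ _ ∷ _ ∷ [])          x (a≢0 , _) = contradiction refl a≢0
  evaluate-quartic (_ ∷ _ ∷ _ ∷ _ ∷ [])      x (a≢0 , _) = contradiction refl a≢0
  -- Trailing zeros are allowed, so the tail `f` need not be empty; its coefficients have index at
  -- least 5 in the whole list and vanish.
  evaluate-quartic (_ ∷ _ ∷ _ ∷ _ ∷ a ∷ f)   x (_ , vanish) =
    +-congˡ (*-congˡ (+-congˡ (*-congˡ (+-congˡ (*-congˡ (+-congˡ (*-congˡ (≈-trans
      (+-congˡ (*-congˡ (evaluate-zero f x λ n → vanish (suc (suc (suc (suc (suc n)))))
        (s≤s (s≤s (s≤s (s≤s (s≤s z≤n))))))))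
      (solve 2 (λ x a → a :+ x :* con 0ℚ := a) ≈-refl x (ι a))))))))))

  depressed : (a β h D E : ℚ) → Carrier → Carrier
  depressed a β h D E x =
    let s = x + ι β in ι a * ((s * s + ι h) * (s * s + ι h) + ι D * s + ι E)

  horner₄-depressed : ∀ {a₀ a₁ a₂ a₃ a} (d : Depressed a₀ a₁ a₂ a₃ a) →
                      let open Depressed d in
                      ∀ x → horner₄ a₀ a₁ a₂ a₃ a x ~ depressed a β h D E x
  horner₄-depressed {a = a} d x =
    modulo 𝟙 constantᴬ (modulo x linearᴬ (modulo (x * x) quadraticᴬ (modulo (x * x * x) cubicᴬ
      (solve 10 (λ x a a₀ a₁ a₂ a₃ β h D E →
        a₀ :+ x :* (a₁ :+ x :* (a₂ :+ x :* (a₃ :+ x :* a)))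
        := a :* (((x :+ β) :* (x :+ β) :+ h) :* ((x :+ β) :* (x :+ β) :+ h) :+ D :* (x :+ β) :+ E)
           :+ con 1ℚ :* (a₀ :- a :* ((β :* β :+ h) :* (β :* β :+ h) :+ D :* β :+ E))
           :+ x :* (a₁ :- a :* (con 4ℚ :* (β :* (β :* β)) :+ con 4ℚ :* (h :* β) :+ D))
           :+ x :* x :* (a₂ :- a :* (con 6ℚ :* (β :* β) :+ con 2ℚ :* h))
           :+ x :* x :* x :* (a₃ :- a :* (con 4ℚ :* β)))
        ≈-refl x (ι a) (ι _) (ι _) (ι _) (ι _) (ι β) (ι h) (ι D) (ι E)))))
    where
    open Depressed d
    cubicᴬ : ι _ ~ ι a * (ι 4ℚ * ι β)
    cubicᴬ = ≈-trans (ι-cong cubic) (ι-*′ ≈-refl (ι-* 4ℚ β))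
    quadraticᴬ : ι _ ~ ι a * (ι 6ℚ * (ι β * ι β) + ι 2ℚ * ι h)
    quadraticᴬ = ≈-trans (ι-cong quadratic) (ι-*′ ≈-refl (ι-+′ (ι-*′ ≈-refl (ι-* β β)) (ι-* 2ℚ h)))
    linearᴬ : ι _ ~ ι a * (ι 4ℚ * (ι β * (ι β * ι β)) + ι 4ℚ * (ι h * ι β) + ι D)
    linearᴬ = ≈-trans (ι-cong linear) (ι-*′ ≈-refl (ι-+′ (ι-+′
      (ι-*′ ≈-refl (ι-*′ ≈-refl (ι-* β β))) (ι-*′ ≈-refl (ι-* h β))) ≈-refl))
    constantᴬ : ι _ ~ ι a * ((ι β * ι β + ι h) * (ι β * ι β + ι h) + ι D * ι β + ι E)
    constantᴬ = ≈-trans (ι-cong constant) (ι-*′ ≈-refl (ι-+′ (ι-+′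
      (ι-*′ (ι-+′ (ι-* β β) ≈-refl) (ι-+′ (ι-* β β) ≈-refl)) (ι-* D β)) ≈-refl))

-- A rational point off the zeros of the quartic and of its covariant

module _ where
  open import Data.Rational using (_+_; _*_; -_; _-_; _≤_; _<_)
  open +-*-Solver

  0≤+ : ∀ {p q} → 0ℚ ≤ p → 0ℚ ≤ q → 0ℚ ≤ p + q
  0≤+ = ℚ.+-mono-≤

  0≤* : ∀ {p q} → 0ℚ ≤ p → 0ℚ ≤ q → 0ℚ ≤ p * q
  0≤* {p} {q} 0≤p 0≤q = ℚ.nonNegative⁻¹ (p * q)
    {{ℚ.nonNeg*nonNeg⇒nonNeg p {{ℚ.nonNegative 0≤p}} q {{ℚ.nonNegative 0≤q}}}}

  1+nonNeg≢0 : ∀ {p} → 0ℚ ≤ p → 1ℚ + p ≢ 0ℚ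
  1+nonNeg≢0 {p} 0≤p 1+p≡0 = ℚ.<-irrefl (sym 1+p≡0) (ℚ.+-mono-<-≤ {0ℚ} {1ℚ} {0ℚ} {p} (ℚ.positive⁻¹ 1ℚ) 0≤p)

  -- The absolute value, in a form suited to `pivot`: the summands b + p and b - p are nonnegative,
  -- and b² can be exchanged for p².
  magnitude : ∀ p → ∃ λ b → 0ℚ ≤ b × 0ℚ ≤ b + p × 0ℚ ≤ b - p × b * b ≡ p * p
  magnitude p with ℚ.≤-total 0ℚ p
  ... | inj₁ 0≤p = p , 0≤p , 0≤+ 0≤p 0≤p , ℚ.≤-reflexive (sym (ℚ.+-inverseʳ p)) , refl
  ... | inj₂ p≤0 = - p , 0≤-p , ℚ.≤-reflexive (sym (ℚ.+-inverseˡ p)) , 0≤+ 0≤-p 0≤-p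
                 , solve 1 (λ p → (:- p) :* (:- p) := p :* p) refl p
    where
    0≤-p : 0ℚ ≤ - p
    0≤-p = ℚ.neg-antimono-≤ p≤0

  -- The second condition says that ρ is not a root, so that moving ρ to ∞ leaves the degree at 4;
  -- the other two keep the covariant factor ρ (h² + E - ρ⁴) nonzero. The choice ρ = 1 + |h| + |E|
  -- is large enough for each critical expression to be, up to sign, 1 plus nonnegative terms.
  pivot : ∀ h E → ∃ λ ρ → ρ ≢ 0ℚ × (ρ * ρ + h) * (ρ * ρ + h) + E ≢ 0ℚ × h * h + E - ρ * ρ * (ρ * ρ) ≢ 0ℚ
  pivot h E with magnitude h | magnitude E
  ... | b , 0≤b , 0≤b+h , _ , bb≡hh | e , 0≤e , 0≤e+E , 0≤e-E , _ = ρ , ρ≢0 , first , second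
    where
    ρ w v : ℚ
    ρ = 1ℚ + (b + e)
    ρ≢0 : ρ ≢ 0ℚ
    ρ≢0 = 1+nonNeg≢0 (0≤+ 0≤b 0≤e)
    -- Chosen so that ρ² + h = 1 + e + w.
    w = (b + h) + (b + e + b * b + e * e + 2ℚ * (b * e))
    0≤2 : 0ℚ ≤ 2ℚ
    0≤2 = ℚ.nonNegative⁻¹ 2ℚ
    0≤1 : 0ℚ ≤ 1ℚ
    0≤1 = ℚ.nonNegative⁻¹ 1ℚ
    0≤w : 0ℚ ≤ w
    0≤w = 0≤+ 0≤b+h (0≤+ (0≤+ (0≤+ (0≤+ 0≤b 0≤e) (0≤* 0≤b 0≤b)) (0≤* 0≤e 0≤e)) (0≤* 0≤2 (0≤* 0≤b 0≤e)))
    first : (ρ * ρ + h) * (ρ * ρ + h) + E ≢ 0ℚ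
    first = subst (_≢ 0ℚ)
      (solve 4 (λ b e h E → let w = (b :+ h) :+ (b :+ e :+ b :* b :+ e :* e :+ con 2ℚ :* (b :* e))
                                ρ = con 1ℚ :+ (b :+ e) in
        con 1ℚ :+ ((e :+ E) :+ (e :+ e :* e :+ con 2ℚ :* ((con 1ℚ :+ e) :* w) :+ w :* w))
        := (ρ :* ρ :+ h) :* (ρ :* ρ :+ h) :+ E) refl b e h E)
      (1+nonNeg≢0 (0≤+ 0≤e+E (0≤+ (0≤+ (0≤+ 0≤e (0≤* 0≤e 0≤e)) (0≤* 0≤2 (0≤* (0≤+ 0≤1 0≤e) 0≤w))) (0≤* 0≤w 0≤w))))
    v = e * e + 2ℚ * b + e + 2ℚ * (b * e)
    0≤v : 0ℚ ≤ v
    0≤v = 0≤+ (0≤+ (0≤+ (0≤* 0≤e 0≤e) (0≤* 0≤2 0≤b)) 0≤e) (0≤* 0≤2 (0≤* 0≤b 0≤e))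
    r : ℚ
    -- Chosen so that ρ² = 1 + r; hence ρ⁴ - h² - E is 1 + (e - E) plus nonnegative terms once h² is
    -- replaced by b².
    r = b * b + (v + e)
    0≤r : 0ℚ ≤ r
    0≤r = 0≤+ (0≤* 0≤b 0≤b) (0≤+ 0≤v 0≤e)
    second : h * h + E - ρ * ρ * (ρ * ρ) ≢ 0ℚ
    second ≡0 = 1+nonNeg≢0 (0≤+ 0≤e-E (0≤+ (0≤+ (0≤+ 0≤e (0≤* 0≤2 0≤v)) (0≤* 0≤b 0≤b)) (0≤* 0≤r 0≤r)))
      (ℚ-modulo (- 1ℚ) ≡0 (ℚ-modulo (- 1ℚ) bb≡hh
        (solve 4 (λ b e h E → let v = e :* e :+ con 2ℚ :* b :+ e :+ con 2ℚ :* (b :* e)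
                                  r = b :* b :+ (v :+ e)
                                  ρ = con 1ℚ :+ (b :+ e) in
          con 1ℚ :+ ((e :- E) :+ (e :+ con 2ℚ :* v :+ b :* b :+ r :* r))
          := con 0ℚ :+ (:- con 1ℚ) :* (h :* h :+ E :- ρ :* ρ :* (ρ :* ρ) :- con 0ℚ)
             :+ (:- con 1ℚ) :* (b :* b :- h :* h)) refl b e h E)))

-- Rational curves

module _ where
  open import Data.Rational using (_+_; _*_; -_; _-_)
  open +-*-Solver

  -- With constant term a, these are the coefficients of T⁴ g(ρ + 1 / T) for g = a ((s² + h)² + E).
  -- The left side is the expression of `covariant` for this quartic, so up to a constant it is the
  -- covariant of g at ρ.
  inverted-covariant : ∀ a h E ρ → let η = ρ * ρ + h
                                       a₁ = 4ℚ * (a * ρ)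
                                       a₂ = a * (4ℚ * (ρ * ρ) + 2ℚ * η)
                                       a₃ = 4ℚ * (a * (ρ * η))
                                       a₄ = a * (η * η + E) in
    a₁ * (a₄ * a₄) - ½ * (a₂ * (a₃ * a₄)) + ⅛ * (a₃ * (a₃ * a₃))
    ≡ 4ℚ * (a * (a * a) * (ρ * E)) * (h * h + E - ρ * ρ * (ρ * ρ))
  inverted-covariant = solve 4 (λ a h E ρ → let η = ρ :* ρ :+ h
                                                a₁ = con 4ℚ :* (a :* ρ)
                                                a₂ = a :* (con 4ℚ :* (ρ :* ρ) :+ con 2ℚ :* η)
                                                a₃ = con 4ℚ :* (a :* (ρ :* η))
                                                a₄ = a :* (η :* η :+ E) in
    a₁ :* (a₄ :* a₄) :- con ½ :* (a₂ :* (a₃ :* a₄)) :+ con ⅛ :* (a₃ :* (a₃ :* a₃))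
    := con 4ℚ :* (a :* (a :* a) :* (ρ :* E)) :* (h :* h :+ E :- ρ :* ρ :* (ρ :* ρ))) refl

  neg-square : ∀ p → (- p) * (- p) ≡ p * p
  neg-square = solve 1 (λ p → (:- p) :* (:- p) := p :* p) refl

  neg-involutive : ∀ p → - - p ≡ p
  neg-involutive = solve 1 (λ p → :- (:- p) := p) refl

  unit-cancel : ∀ h l e → h * l ≡ 1ℚ → h * - (l * e) ≡ - e
  unit-cancel h l e hl≡1 = ℚ-modulo (- e) hl≡1
    (solve 3 (λ h l e → h :* :- (l :* e) := (:- e) :+ (:- e) :* (h :* l :- con 1ℚ)) refl h l e)

  pole-value : ∀ n C k → ½ * (n * n * C) * (½ * C) ≡ (½ * (n * C)) * (½ * (n * C)) + k * (0ℚ * 0ℚ)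
  pole-value = solve 3 (λ n C k → con ½ :* (n :* n :* C) :* (con ½ :* C)
    := (con ½ :* (n :* C)) :* (con ½ :* (n :* C)) :+ k :* (con 0ℚ :* con 0ℚ)) refl

  -- The value h² m⁴ / 4 changes by 15 / 4 h² between m = 1 and m = 2, so a cannot equal both.
  square-gap : ∀ {a h} → h ≢ 0ℚ → a - ½ * (h * (1ℚ * 1ℚ)) * (½ * (h * (1ℚ * 1ℚ))) ≡ 0ℚ →
               a - ½ * (h * (2ℚ * 2ℚ)) * (½ * (h * (2ℚ * 2ℚ))) ≢ 0ℚ
  square-gap {a} {h} h≢0 at-1 at-2 = ℚ-*-nonzero {ℤ.+ 15 ℚ./ 4} (λ ()) (ℚ-*-nonzero h≢0 h≢0)
    (ℚ-modulo 1ℚ at-1 (ℚ-modulo (- 1ℚ) at-2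
      (solve 2 (λ a h → con (ℤ.+ 15 ℚ./ 4) :* (h :* h) := con 0ℚ
        :+ con 1ℚ :* (a :- con ½ :* (h :* (con 1ℚ :* con 1ℚ)) :* (con ½ :* (h :* (con 1ℚ :* con 1ℚ))) :- con 0ℚ)
        :+ (:- con 1ℚ) :* (a :- con ½ :* (h :* (con 2ℚ :* con 2ℚ)) :* (con ½ :* (h :* (con 2ℚ :* con 2ℚ))) :- con 0ℚ)) refl a h)))

module Constructions (𝔽 : PlacedField) where
  open PlacedField 𝔽
  open Solver
  open Sections 𝔽
  open QuarticEvaluation algebra

  u⁴ : Carrier
  u⁴ = u * u * (u * u)

  u⁴⇝0 : u⁴ ⇝ 0ℚ
  u⁴⇝0 = ⇝-* (⇝-* u⇝0 u⇝0) (⇝-* u⇝0 u⇝0)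

  uu⁻¹~1 : u * u ⁻¹ ~ 𝟙
  uu⁻¹~1 = inverseʳ u≁0

  -- A constant φ would leave (φ + b) w with the residue 0, inherited from `w`.
  pole⇒non-constant : ∀ {φ w σ} b → (φ + ι b) * w ⇝ σ → σ ≢ 0ℚ → w ⇝ 0ℚ → ∀ c → φ ≁ ι c
  pole⇒non-constant {φ} {w} {σ} b φw⇝σ σ≢0 w⇝0 c φ~c = σ≢0 (⇝-unique φw⇝σ
    (⇝-value (ℚ.*-zeroʳ (c ℚ.+ b)) (⇝-resp (*-congʳ (+-congʳ (≈-sym φ~c))) (⇝-* (⇝-+ (⇝-ι c) (⇝-ι b)) w⇝0))))

  -- Serves the Möbius case, whose base change has no pole at the place: there 1 / T vanishes
  -- without being zero, whereas a constant of residue 0 is zero.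
  zero⇒non-constant : ∀ {φ} b → φ + ι b ≁ 𝟘 → φ + ι b ⇝ 0ℚ → ∀ c → φ ≁ ι c
  zero⇒non-constant {φ} b φ≁0 φ⇝0 c φ~c = φ≁0 (≈-trans (+-congʳ φ~c) (≈-trans (≈-sym (ι-+ c b)) (ι-cong
    (⇝-unique (⇝-resp (+-congʳ (≈-sym φ~c)) (⇝-+ (⇝-ι c) (⇝-ι b))) φ⇝0))))

  -- y² = x³ + (κ² + 2 κ) x has the point (1 , 1 + κ); twist it by μ.
  twisted-section : ∀ f {φ μ κ} → (∀ c → φ ≁ ι c) → μ ≁ 𝟘 → κ ⇝ 0ℚ →
                    evaluate f φ ~ (μ * μ) * (μ * μ) * (κ * κ + ι 2ℚ * κ) → Section f
  twisted-section f {φ} {μ} {κ} φ-non-constant μ≁0 κ⇝0 f[φ]~ = record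
    { φ = φ ; x = μ * μ ; y = μ * (μ * μ) * (𝟙 + κ) ; κ = κ * κ + ι 2ℚ * κ
    ; non-constant = φ-non-constant
    ; on-curve     = modulo (- (μ * μ)) f[φ]~
        (solve 3 (λ A μ κ → (μ :* (μ :* μ) :* (con 1ℚ :+ κ)) :* (μ :* (μ :* μ) :* (con 1ℚ :+ κ))
          := μ :* μ :* (μ :* μ) :* (μ :* μ) :+ A :* (μ :* μ) :+ con 0ℚ
             :+ (:- (μ :* μ)) :* (A :- μ :* μ :* (μ :* μ) :* (κ :* κ :+ con 2ℚ :* κ))) ≈-refl (evaluate f φ) μ κ)
    ; x≁0          = *-≁0 μ≁0 μ≁0
    ; coefficient  = ≈-trans f[φ]~ (*-comm _ _)
    ; κ⇝0          = ⇝-+ (⇝-* κ⇝0 κ⇝0) (⇝-* (⇝-ι 2ℚ) κ⇝0) }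

  -- Formulated in the shifted variable s alone, so that it serves both the given quartic and the
  -- one obtained by the Möbius substitution. As σ ≠ 0, s is not regular at the place.
  record RationalCurve (a h D E : ℚ) : Set where
    field
      s μ κ : Carrier
      σ     : ℚ
      σ≢0   : σ ≢ 0ℚ
      pole  : s * u⁴ ⇝ σ
      μ≁0   : μ ≁ 𝟘
      κ⇝0   : κ ⇝ 0ℚ
      curve : ι a * ((s * s + ι h) * (s * s + ι h) + ι D * s + ι E)
              ~ (μ * μ) * (μ * μ) * (κ * κ + ι 2ℚ * κ)

  -- With m = 1 / u, s solves D s + E = 4 a m⁴, so that, with V = s² + h, the quartic
  -- a (V² + 4 a m⁴) is k² + 2 k μ² for k = 2 a m² and μ = V / (2 m); κ is k / μ².
  rational-curve : ∀ {a D} h E → a ≢ 0ℚ → D ≢ 0ℚ → RationalCurve a h D E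
  rational-curve {a} {D} h E a≢0 D≢0 = record
    { s = s ; μ = μ ; κ = κ ; σ = σ ; σ≢0 = σ≢0 ; pole = pole ; μ≁0 = μ≁0 ; κ⇝0 = κ⇝0 ; curve = curve }
    where
    d σ : ℚ
    d = proj₁ (ℚ-recip D D≢0)
    σ = d ℚ.* (4ℚ ℚ.* a)
    Dd≡1 : D ℚ.* d ≡ 1ℚ
    Dd≡1 = proj₂ (ℚ-recip D D≢0)
    Dd~1 : ι D * ι d ~ 𝟙
    Dd~1 = ≈-trans (≈-sym (ι-* D d)) (ι-cong Dd≡1)
    σ≢0 : σ ≢ 0ℚ
    σ≢0 = ℚ-*-nonzero (ℚ-unit-nonzero {d} {D} (trans (ℚ.*-comm d D) Dd≡1)) (ℚ-*-nonzero {4ℚ} (λ ()) a≢0)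
    m m⁴ s V : Carrier
    m = u ⁻¹
    m⁴ = m * m * (m * m)
    s = ι d * (ι 4ℚ * ι a * m⁴ - ι E)
    V = s * s + ι h
    u⁴m⁴~1 : u⁴ * m⁴ ~ 𝟙
    u⁴m⁴~1 = modulo ((u * m + 𝟙) * (u * m * (u * m) + 𝟙)) uu⁻¹~1
      (solve 2 (λ u m → u :* u :* (u :* u) :* (m :* m :* (m :* m))
        := con 1ℚ :+ (u :* m :+ con 1ℚ) :* (u :* m :* (u :* m) :+ con 1ℚ) :* (u :* m :- con 1ℚ)) ≈-refl u m)
    pole : s * u⁴ ⇝ σ
    pole = ⇝-resp
      (modulo (- (ι d * (ι 4ℚ * ι a))) u⁴m⁴~1
        (solve 5 (λ d a E u⁴ m⁴ → d :* (con 4ℚ :* a :- E :* u⁴)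
          := d :* (con 4ℚ :* a :* m⁴ :- E) :* u⁴ :+ (:- (d :* (con 4ℚ :* a))) :* (u⁴ :* m⁴ :- con 1ℚ))
          ≈-refl (ι d) (ι a) (ι E) u⁴ m⁴))
      (⇝-value (cong (d ℚ.*_) (trans (cong (λ e → 4ℚ ℚ.* a ℚ.- e) (ℚ.*-zeroʳ E)) (ℚ.+-identityʳ (4ℚ ℚ.* a))))
        (⇝-* (⇝-ι d) (⇝-- (⇝-* (⇝-ι 4ℚ) (⇝-ι a)) (⇝-* (⇝-ι E) u⁴⇝0))))
    V-pole : V * (u⁴ * u⁴) ⇝ σ ℚ.* σ
    V-pole = ⇝-resp
      (solve 3 (λ s h u⁴ → (s :* u⁴) :* (s :* u⁴) :+ h :* (u⁴ :* u⁴) := (s :* s :+ h) :* (u⁴ :* u⁴)) ≈-refl s (ι h) u⁴)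
      (⇝-value (trans (cong (σ ℚ.* σ ℚ.+_) (ℚ.*-zeroʳ h)) (ℚ.+-identityʳ (σ ℚ.* σ)))
        (⇝-+ (⇝-* pole pole) (⇝-* (⇝-ι h) (⇝-* u⁴⇝0 u⁴⇝0))))
    V≁0 : V ≁ 𝟘
    V≁0 = *≁0⇒≁0ˡ (⇝⇒≁0 V-pole (ℚ-*-nonzero σ≢0 σ≢0))
    W μ k κ : Carrier
    W = V ⁻¹
    μ = ι ½ * (V * u)
    k = ι 2ℚ * (ι a * (m * m))
    κ = ι 8ℚ * (ι a * (m⁴ * (W * W)))
    μ≁0 : μ ≁ 𝟘
    μ≁0 = *-≁0 (⇝⇒≁0 (⇝-ι ½) λ ()) (*-≁0 V≁0 u≁0)
    VW~1 : V * W ~ 𝟙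
    VW~1 = inverseʳ V≁0
    -- Multiplying κ = 8 a m⁴ / V² by (V u⁸)², whose residue is σ⁴, leaves 8 a u¹².
    κ⇝0 : κ ⇝ 0ℚ
    κ⇝0 = ⇝-quotient
      (modulo (ι 8ℚ * (ι a * ((V * W + 𝟙) * (m⁴ * (u⁴ * u⁴ * (u⁴ * u⁴)))))) VW~1
        (modulo (ι 8ℚ * (ι a * (u⁴ * u⁴ * u⁴))) u⁴m⁴~1
        (solve 5 (λ a V W u⁴ m⁴ → con 8ℚ :* (a :* (m⁴ :* (W :* W))) :* ((V :* (u⁴ :* u⁴)) :* (V :* (u⁴ :* u⁴)))
          := con 8ℚ :* a :* (u⁴ :* u⁴ :* u⁴)
             :+ con 8ℚ :* (a :* ((V :* W :+ con 1ℚ) :* (m⁴ :* (u⁴ :* u⁴ :* (u⁴ :* u⁴))))) :* (V :* W :- con 1ℚ)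
             :+ con 8ℚ :* (a :* (u⁴ :* u⁴ :* u⁴)) :* (u⁴ :* m⁴ :- con 1ℚ)) ≈-refl (ι a) V W u⁴ m⁴)))
      (⇝-* (⇝-* (⇝-ι 8ℚ) (⇝-ι a)) (⇝-* (⇝-* u⁴⇝0 u⁴⇝0) u⁴⇝0))
      (⇝-* V-pole V-pole)
      (ℚ-*-nonzero (ℚ-*-nonzero σ≢0 σ≢0) (ℚ-*-nonzero σ≢0 σ≢0))
      (trans (ℚ.*-zeroˡ (σ ℚ.* σ ℚ.* (σ ℚ.* σ))) (sym (ℚ.*-zeroʳ (8ℚ ℚ.* a))))
    μ²κ~k : μ * μ * κ ~ k
    μ²κ~k = modulo (ι 2ℚ * (ι a * ((V * W + 𝟙) * (m * m * (u * m * (u * m)))))) VW~1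
      (modulo (ι 2ℚ * (ι a * (m * m * (u * m + 𝟙)))) uu⁻¹~1
        (solve 5 (λ a V W u m → (con ½ :* (V :* u)) :* (con ½ :* (V :* u)) :* (con 8ℚ :* (a :* (m :* m :* (m :* m) :* (W :* W))))
          := con 2ℚ :* (a :* (m :* m))
             :+ con 2ℚ :* (a :* ((V :* W :+ con 1ℚ) :* (m :* m :* (u :* m :* (u :* m))))) :* (V :* W :- con 1ℚ)
             :+ con 2ℚ :* (a :* (m :* m :* (u :* m :+ con 1ℚ))) :* (u :* m :- con 1ℚ)) ≈-refl (ι a) V W u m))
    -- Two stages: D s + E = 4 a m⁴ turns the left side into k² + 2 μ² k, and then k is replaced by
    -- μ² κ.
    curve : ι a * (V * V + ι D * s + ι E) ~ (μ * μ) * (μ * μ) * (κ * κ + ι 2ℚ * κ)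
    curve = ≈-trans
      (modulo (ι a * (ι 4ℚ * ι a * m⁴ - ι E)) Dd~1 (modulo (- (ι a * (V * V) * (u * m + 𝟙))) uu⁻¹~1
        (solve 8 (λ a V D d E u m m⁴ → a :* (V :* V :+ D :* (d :* (con 4ℚ :* a :* m⁴ :- E)) :+ E)
          := con 4ℚ :* (a :* (a :* m⁴)) :+ con 2ℚ :* ((con ½ :* (V :* u)) :* (con ½ :* (V :* u)) :* (con 2ℚ :* (a :* (m :* m))))
             :+ a :* (con 4ℚ :* a :* m⁴ :- E) :* (D :* d :- con 1ℚ)
             :+ (:- (a :* (V :* V) :* (u :* m :+ con 1ℚ))) :* (u :* m :- con 1ℚ)) ≈-refl (ι a) V (ι D) (ι d) (ι E) u m m⁴)))
      (modulo (- (μ * μ * κ + k + ι 2ℚ * (μ * μ))) μ²κ~k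
        (solve 4 (λ a m μ κ → let k = con 2ℚ :* (a :* (m :* m)) in
          con 4ℚ :* (a :* (a :* (m :* m :* (m :* m)))) :+ con 2ℚ :* (μ :* μ :* k)
          := (μ :* μ) :* (μ :* μ) :* (κ :* κ :+ con 2ℚ :* κ)
             :+ (:- (μ :* μ :* κ :+ k :+ con 2ℚ :* (μ :* μ))) :* (μ :* μ :* κ :- k)) ≈-refl (ι a) m μ κ))

  section-of-non-even : ∀ f {a β h D E} → (∀ x → evaluate f x ~ depressed a β h D E x) →
                        a ≢ 0ℚ → D ≢ 0ℚ → Section f
  section-of-non-even f {a} {β} {h} {D} {E} f~ a≢0 D≢0 =
    twisted-section f (pole⇒non-constant β (⇝-resp (*-congʳ (≈-sym φ+β~s)) pole) σ≢0 u⁴⇝0) μ≁0 κ⇝0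
      (≈-trans (f~ (s - ι β)) (≈-trans (*-congˡ (+-congʳ (+-cong (*-cong s²+h s²+h) (*-congˡ φ+β~s)))) curve))
    where
    open RationalCurve (rational-curve h E a≢0 D≢0)
    φ+β~s : s - ι β + ι β ~ s
    φ+β~s = solve 2 (λ s β → s :- β :+ β := s) ≈-refl s (ι β)
    s²+h : (s - ι β + ι β) * (s - ι β + ι β) + ι h ~ s * s + ι h
    s²+h = +-congʳ (*-cong φ+β~s φ+β~s)

  section-of-even : ∀ f {a β h E} → (∀ x → evaluate f x ~ depressed a β h 0ℚ E x) →
                    a ≢ 0ℚ → E ≢ 0ℚ → Section f
  section-of-even f {a} {β} {h} {E} f~ a≢0 E≢0 = twisted-section f
    (zero⇒non-constant (β ℚ.- ρ) (λ φ~0 → τ≁0 (≈-trans (≈-sym φ+β-ρ~τ) φ~0)) (⇝-resp (≈-sym φ+β-ρ~τ) τ⇝0))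
    -- The factor τ⁴ of f(φ) is absorbed by replacing μ with τ μ; κ stays the same.
    (*-≁0 τ≁0 μ≁0) κ⇝0
    (≈-trans (f~ φ) (≈-trans inverted (≈-trans (*-congˡ (≈-trans (horner₄-depressed d T) (≈-trans shifted curve)))
      (solve 3 (λ τ μ κ → τ :* τ :* (τ :* τ) :* ((μ :* μ) :* (μ :* μ) :* (κ :* κ :+ con 2ℚ :* κ))
        := ((τ :* μ) :* (τ :* μ)) :* ((τ :* μ) :* (τ :* μ)) :* (κ :* κ :+ con 2ℚ :* κ)) ≈-refl τ μ κ))))
    where
    ρ η γ a₁ a₂ a₃ a₄ : ℚ
    ρ  = proj₁ (pivot h E)
    η  = ρ ℚ.* ρ ℚ.+ h
    γ  = η ℚ.* η ℚ.+ E
    a₁ = 4ℚ ℚ.* (a ℚ.* ρ)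
    a₂ = a ℚ.* (4ℚ ℚ.* (ρ ℚ.* ρ) ℚ.+ 2ℚ ℚ.* η)
    a₃ = 4ℚ ℚ.* (a ℚ.* (ρ ℚ.* η))
    a₄ = a ℚ.* γ
    a₄≢0 : a₄ ≢ 0ℚ
    a₄≢0 = ℚ-*-nonzero a≢0 (proj₁ (proj₂ (proj₂ (pivot h E))))
    d : Depressed a a₁ a₂ a₃ a₄
    d = depress a a₁ a₂ a₃ a₄≢0
    open Depressed d renaming (β to β′; h to h′; D to D′; E to E′) using ()
    -- If D′ were 0, the covariant of the new quartic would vanish at ∞, although none of its
    -- factors 4, a³, ρ, E and h² + E - ρ⁴ does.
    D′≢0 : D′ ≢ 0ℚ
    D′≢0 D′≡0 = ℚ-*-nonzero
      (ℚ-*-nonzero {4ℚ} (λ ()) (ℚ-*-nonzero (ℚ-*-nonzero a≢0 (ℚ-*-nonzero a≢0 a≢0))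
        (ℚ-*-nonzero (proj₁ (proj₂ (pivot h E))) E≢0)))
      (proj₂ (proj₂ (proj₂ (pivot h E))))
      (trans (sym (trans (covariant d) (inverted-covariant a h E ρ)))
        (trans (cong (ℚ._* (a₄ ℚ.* (a₄ ℚ.* a₄))) D′≡0) (ℚ.*-zeroˡ (a₄ ℚ.* (a₄ ℚ.* a₄)))))
    open RationalCurve (rational-curve h′ E′ a₄≢0 D′≢0)
    T τ φ : Carrier
    T = s - ι β′
    Tu⁴⇝σ : T * u⁴ ⇝ σ
    Tu⁴⇝σ = ⇝-resp
      (solve 3 (λ s β′ u⁴ → s :* u⁴ :- β′ :* u⁴ := (s :- β′) :* u⁴) ≈-refl s (ι β′) u⁴)
      (⇝-value (trans (cong (λ e → σ ℚ.- e) (ℚ.*-zeroʳ β′)) (ℚ.+-identityʳ σ)) (⇝-- pole (⇝-* (⇝-ι β′) u⁴⇝0)))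
    τ = T ⁻¹
    Tτ~1 : T * τ ~ 𝟙
    Tτ~1 = inverseʳ (*≁0⇒≁0ˡ (⇝⇒≁0 Tu⁴⇝σ σ≢0))
    τ≁0 : τ ≁ 𝟘
    τ≁0 = unit⇒≁0 (≈-trans (*-comm τ T) Tτ~1)
    τ⇝0 : τ ⇝ 0ℚ
    τ⇝0 = ⇝-quotient
      (modulo u⁴ Tτ~1 (solve 3 (λ T τ u⁴ → τ :* (T :* u⁴) := u⁴ :+ u⁴ :* (T :* τ :- con 1ℚ)) ≈-refl T τ u⁴))
      u⁴⇝0 Tu⁴⇝σ σ≢0 (ℚ.*-zeroˡ σ)
    φ = ι ρ + τ - ι β
    φ+β-ρ~τ : φ + ι (β ℚ.- ρ) ~ τ
    φ+β-ρ~τ = ≈-trans (+-congˡ (ι-+′ ≈-refl (ι-neg ρ)))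
      (solve 3 (λ ρ τ β → ρ :+ τ :- β :+ (β :+ :- ρ) := τ) ≈-refl (ι ρ) τ (ι β))
    φ+β~ρ+τ : φ + ι β ~ ι ρ + τ
    φ+β~ρ+τ = solve 3 (λ ρ τ β → ρ :+ τ :- β :+ β := ρ :+ τ) ≈-refl (ι ρ) τ (ι β)
    T+β′~s : T + ι β′ ~ s
    T+β′~s = solve 2 (λ s β → s :- β :+ β := s) ≈-refl s (ι β′)
    shifted : depressed a₄ β′ h′ D′ E′ T ~ ι a₄ * ((s * s + ι h′) * (s * s + ι h′) + ι D′ * s + ι E′)
    shifted = *-congˡ (+-congʳ (+-cong (*-cong s²+h s²+h) (*-congˡ T+β′~s)))
      where
      s²+h : (T + ι β′) * (T + ι β′) + ι h′ ~ s * s + ι h′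
      s²+h = +-congʳ (*-cong T+β′~s T+β′~s)
    ιη : ι η ~ ι ρ * ι ρ + ι h
    ιη = ι-+′ (ι-* ρ ρ) ≈-refl
    -- T⁴ g(ρ + 1 / T) written out as a quartic in T.
    inverted : depressed a β h 0ℚ E φ ~ (τ * τ) * (τ * τ) * horner₄ a a₁ a₂ a₃ a₄ T
    inverted = ≈-trans
      (*-congˡ (+-congʳ (+-cong (*-cong s²+h s²+h) (*-congˡ φ+β~ρ+τ))))
      (≈-trans
        (≈-trans
          (*-congˡ (+-cong (+-cong (*-cong factor factor) ≈-refl) one))
          (solve 6 (λ a h E ρ T τ → let V = (ρ :* T :+ con 1ℚ) :* (ρ :* T :+ con 1ℚ) :+ h :* (T :* T)
                                        η = ρ :* ρ :+ h in
            a :* ((τ :* τ :* V) :* (τ :* τ :* V) :+ con 0ℚ :* (ρ :+ τ) :+ E :* ((τ :* τ) :* (τ :* τ) :* (T :* T :* (T :* T))))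
            := (τ :* τ) :* (τ :* τ) :* (a :+ T :* (con 4ℚ :* (a :* ρ) :+ T :* (a :* (con 4ℚ :* (ρ :* ρ) :+ con 2ℚ :* η)
                 :+ T :* (con 4ℚ :* (a :* (ρ :* η)) :+ T :* (a :* (η :* η :+ E)))))))
            ≈-refl (ι a) (ι h) (ι E) (ι ρ) T τ))
        (*-congˡ (+-congˡ (*-congˡ (+-cong (≈-sym (ι-*′ ≈-refl (ι-* a ρ))) (*-congˡ (+-cong
          (≈-sym (ι-*′ ≈-refl (ι-+′ (ι-*′ ≈-refl (ι-* ρ ρ)) (ι-*′ ≈-refl ιη))))
          (*-congˡ (+-cong (≈-sym (ι-*′ ≈-refl (ι-*′ ≈-refl (ι-*′ ≈-refl ιη))))
            (*-congˡ (≈-sym (ι-*′ ≈-refl (ι-+′ (ι-*′ ιη ιη) ≈-refl)))))))))))))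
      where
      s²+h : (φ + ι β) * (φ + ι β) + ι h ~ (ι ρ + τ) * (ι ρ + τ) + ι h
      s²+h = +-congʳ (*-cong φ+β~ρ+τ φ+β~ρ+τ)
      factor : (ι ρ + τ) * (ι ρ + τ) + ι h ~ (τ * τ) * ((ι ρ * T + 𝟙) * (ι ρ * T + 𝟙) + ι h * (T * T))
      factor = modulo (- (ι ρ * (ι ρ * (T * τ + 𝟙) + ι 2ℚ * τ) + ι h * (T * τ + 𝟙))) Tτ~1
        (solve 4 (λ h ρ T τ → (ρ :+ τ) :* (ρ :+ τ) :+ h
          := (τ :* τ) :* ((ρ :* T :+ con 1ℚ) :* (ρ :* T :+ con 1ℚ) :+ h :* (T :* T))
             :+ (:- (ρ :* (ρ :* (T :* τ :+ con 1ℚ) :+ con 2ℚ :* τ) :+ h :* (T :* τ :+ con 1ℚ))) :* (T :* τ :- con 1ℚ))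
          ≈-refl (ι h) (ι ρ) T τ)
      one : ι E ~ ι E * ((τ * τ) * (τ * τ) * (T * T * (T * T)))
      one = modulo (- (ι E * ((T * τ + 𝟙) * (T * τ * (T * τ) + 𝟙)))) Tτ~1
        (solve 3 (λ E T τ → E := E :* ((τ :* τ) :* (τ :* τ) :* (T :* T :* (T :* T)))
          :+ (:- (E :* ((T :* τ :+ con 1ℚ) :* (T :* τ :* (T :* τ) :+ con 1ℚ)))) :* (T :* τ :- con 1ℚ)) ≈-refl (ι E) T τ)

  -- On s² + h = Q, the twist Q y² = x³ + a x is parametrised through x = r²: then x² + a
  -- must equal (x + k)² + h q² with s = (x + k) / q, and for k = − h m² / 2 this reads
  -- − h (m r − q)(m r + q) = a − k², which is solved by m r − q = u and m r + q = C / u.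
  section-of-square : ∀ f {a β h} m → (∀ x → evaluate f x ~ depressed a β h 0ℚ 0ℚ x) →
                      a ≢ 0ℚ → h ≢ 0ℚ → m ≢ 0ℚ →
                      a ℚ.- (½ ℚ.* (h ℚ.* (m ℚ.* m))) ℚ.* (½ ℚ.* (h ℚ.* (m ℚ.* m))) ≢ 0ℚ → Section f
  section-of-square f {a} {β} {h} m f~ a≢0 h≢0 m≢0 a-k²≢0 = record
    { φ = φ ; x = Q * (r * r) ; y = Q * Q * (r * q) ; κ = ι a * (j * j * (j * j))
    ; non-constant = pole⇒non-constant β (⇝-resp (*-congʳ (≈-sym φ+β~s)) su⇝) c≢0 u⇝0
    ; on-curve     = modulo (Q * Q * Q * (r * r)) Qq²~ (modulo (- (Q * (r * r))) f[φ]~aQ²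
        (solve 5 (λ A a Q r q → (Q :* Q :* (r :* q)) :* (Q :* Q :* (r :* q))
          := (Q :* (r :* r)) :* (Q :* (r :* r)) :* (Q :* (r :* r)) :+ A :* (Q :* (r :* r)) :+ con 0ℚ
             :+ Q :* Q :* Q :* (r :* r) :* (Q :* (q :* q) :- (r :* r :* (r :* r) :+ a))
             :+ (:- (Q :* (r :* r))) :* (A :- a :* (Q :* Q))) ≈-refl (evaluate f φ) (ι a) Q r q))
    ; x≁0          = *-≁0 Q≁0 (*-≁0 r≁0 r≁0)
    ; coefficient  = ≈-trans f[φ]~aQ² (modulo (- (ι a * (Q * Q) * ((r * j + 𝟙) * (r * j * (r * j) + 𝟙)))) rj~1
        (solve 4 (λ a Q r j → a :* (Q :* Q) := a :* (j :* j :* (j :* j)) :* ((Q :* (r :* r)) :* (Q :* (r :* r)))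
          :+ (:- (a :* (Q :* Q) :* ((r :* j :+ con 1ℚ) :* (r :* j :* (r :* j) :+ con 1ℚ)))) :* (r :* j :- con 1ℚ))
          ≈-refl (ι a) Q r j))
    ; κ⇝0          = κ⇝0 }
    where
    n l k C σ c : ℚ
    n = proj₁ (ℚ-recip m m≢0)
    l = proj₁ (ℚ-recip h h≢0)
    k = ℚ.- (½ ℚ.* (h ℚ.* (m ℚ.* m)))
    -- The product (m r - q)(m r + q) prescribed by the conic. Its being nonzero gives r and q their
    -- poles; `σ` and `c` are the residues of r u and s u.
    C = ℚ.- (l ℚ.* (a ℚ.- k ℚ.* k))
    σ = ½ ℚ.* (n ℚ.* C)
    c = ½ ℚ.* (n ℚ.* n ℚ.* C)
    mn≡1 : m ℚ.* n ≡ 1ℚ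
    mn≡1 = proj₂ (ℚ-recip m m≢0)
    hl≡1 : h ℚ.* l ≡ 1ℚ
    hl≡1 = proj₂ (ℚ-recip h h≢0)
    n≢0 : n ≢ 0ℚ
    n≢0 = ℚ-unit-nonzero {n} {m} (trans (ℚ.*-comm n m) mn≡1)
    C≢0 : C ≢ 0ℚ
    C≢0 C≡0 = ℚ-*-nonzero (ℚ-unit-nonzero {l} {h} (trans (ℚ.*-comm l h) hl≡1))
      (subst (λ k² → a ℚ.- k² ≢ 0ℚ) (sym (neg-square (½ ℚ.* (h ℚ.* (m ℚ.* m))))) a-k²≢0)
      (trans (sym (neg-involutive (l ℚ.* (a ℚ.- k ℚ.* k)))) (cong ℚ.-_ C≡0))
    σ≢0 : σ ≢ 0ℚ
    σ≢0 = ℚ-*-nonzero {½} (λ ()) (ℚ-*-nonzero n≢0 C≢0)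
    c≢0 : c ≢ 0ℚ
    c≢0 = ℚ-*-nonzero {½} (λ ()) (ℚ-*-nonzero (ℚ-*-nonzero n≢0 n≢0) C≢0)
    mn~1 : ι m * ι n ~ 𝟙
    mn~1 = ≈-trans (≈-sym (ι-* m n)) (ι-cong mn≡1)
    k~ : ι k ~ - (ι ½ * (ι h * (ι m * ι m)))
    k~ = ≈-trans (ι-neg _) (-‿cong (ι-*′ ≈-refl (ι-*′ ≈-refl (ι-* m m))))
    hC~ : ι h * ι C ~ - (ι a - ι k * ι k)
    hC~ = ≈-trans (≈-sym (ι-* h C)) (≈-trans (ι-cong (unit-cancel h l (a ℚ.- k ℚ.* k) hl≡1))
      (≈-trans (ι-neg _) (-‿cong (ι-+′ ≈-refl (≈-trans (ι-neg _) (-‿cong (ι-* k k)))))))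
    i r q p s Q φ j : Carrier
    i = u ⁻¹
    r = ι ½ * (ι n * (u + ι C * i))
    q = ι ½ * (ι C * i - u)
    ru⇝σ : r * u ⇝ σ
    ru⇝σ = ⇝-resp
      (modulo (- (ι ½ * (ι n * ι C))) uu⁻¹~1
        (solve 4 (λ n C u i → con ½ :* (n :* (C :+ u :* u)) := con ½ :* (n :* (u :+ C :* i)) :* u
          :+ (:- (con ½ :* (n :* C))) :* (u :* i :- con 1ℚ)) ≈-refl (ι n) (ι C) u i))
      (⇝-value (cong (λ e → ½ ℚ.* (n ℚ.* e)) (ℚ.+-identityʳ C))
        (⇝-* (⇝-ι ½) (⇝-* (⇝-ι n) (⇝-+ (⇝-ι C) (⇝-* u⇝0 u⇝0)))))
    qu⇝ : q * u ⇝ ½ ℚ.* C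
    qu⇝ = ⇝-resp
      (modulo (- (ι ½ * ι C)) uu⁻¹~1
        (solve 3 (λ C u i → con ½ :* (C :- u :* u) := con ½ :* (C :* i :- u) :* u
          :+ (:- (con ½ :* C)) :* (u :* i :- con 1ℚ)) ≈-refl (ι C) u i))
      (⇝-value (cong (½ ℚ.*_) (ℚ.+-identityʳ C)) (⇝-* (⇝-ι ½) (⇝-- (⇝-ι C) (⇝-* u⇝0 u⇝0))))
    r≁0 : r ≁ 𝟘
    r≁0 = *≁0⇒≁0ˡ (⇝⇒≁0 ru⇝σ σ≢0)
    ½C≢0 : ½ ℚ.* C ≢ 0ℚ
    ½C≢0 = ℚ-*-nonzero {½} (λ ()) C≢0
    q≁0 : q ≁ 𝟘
    q≁0 = *≁0⇒≁0ˡ (⇝⇒≁0 qu⇝ ½C≢0)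
    j = r ⁻¹
    p = q ⁻¹
    rj~1 : r * j ~ 𝟙
    rj~1 = inverseʳ r≁0
    qp~1 : q * p ~ 𝟙
    qp~1 = inverseʳ q≁0
    s = (r * r + ι k) * p
    Q = s * s + ι h
    φ = s - ι β
    φ+β~s : φ + ι β ~ s
    φ+β~s = solve 2 (λ s β → s :- β :+ β := s) ≈-refl s (ι β)
    f[φ]~aQ² : evaluate f φ ~ ι a * (Q * Q)
    f[φ]~aQ² = ≈-trans (f~ φ) (≈-trans
      (*-congˡ (+-congʳ (+-cong (*-cong s²+h s²+h) (*-congˡ φ+β~s))))
      (solve 3 (λ a Q s → a :* (Q :* Q :+ con 0ℚ :* s :+ con 0ℚ) := a :* (Q :* Q)) ≈-refl (ι a) Q s))
      where
      s²+h : (φ + ι β) * (φ + ι β) + ι h ~ Q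
      s²+h = +-congʳ (*-cong φ+β~s φ+β~s)
    conic : ι 2ℚ * ι k * (r * r) + ι h * (q * q) ~ ι a - ι k * ι k
    conic = modulo (ι 2ℚ * (r * r)) k~ (modulo (- (ι ¼ * ι h * ((u + ι C * i) * (u + ι C * i)) * (ι m * ι n + 𝟙))) mn~1
      (modulo (- (ι h * ι C)) uu⁻¹~1 (modulo (- 𝟙) hC~
        (solve 8 (λ a h k m n C u i →
            let r = con ½ :* (n :* (u :+ C :* i)) ; q = con ½ :* (C :* i :- u) in
          con 2ℚ :* k :* (r :* r) :+ h :* (q :* q)
          := a :- k :* k
             :+ con 2ℚ :* (r :* r) :* (k :- (:- (con ½ :* (h :* (m :* m)))))
             :+ (:- (con ¼ :* h :* ((u :+ C :* i) :* (u :+ C :* i)) :* (m :* n :+ con 1ℚ))) :* (m :* n :- con 1ℚ)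
             :+ (:- (h :* C)) :* (u :* i :- con 1ℚ)
             :+ (:- con 1ℚ) :* (h :* C :- (:- (a :- k :* k))))
          ≈-refl (ι a) (ι h) (ι k) (ι m) (ι n) (ι C) u i))))
    Qq²~ : Q * (q * q) ~ r * r * (r * r) + ι a
    Qq²~ = modulo ((r * r + ι k) * (r * r + ι k) * (q * p + 𝟙)) qp~1 (modulo 𝟙 conic
      (solve 6 (λ a h k r q p → ((r :* r :+ k) :* p :* ((r :* r :+ k) :* p) :+ h) :* (q :* q)
        := r :* r :* (r :* r) :+ a
           :+ (r :* r :+ k) :* (r :* r :+ k) :* (q :* p :+ con 1ℚ) :* (q :* p :- con 1ℚ)
           :+ con 1ℚ :* (con 2ℚ :* k :* (r :* r) :+ h :* (q :* q) :- (a :- k :* k)))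
        ≈-refl (ι a) (ι h) (ι k) r q p))
    su⇝ : s * u ⇝ c
    su⇝ = ⇝-quotient
      (modulo ((r * r + ι k) * (u * u)) qp~1
        (solve 5 (λ k r q p u → (r :* r :+ k) :* p :* u :* (q :* u)
          := (r :* u) :* (r :* u) :+ k :* (u :* u) :+ (r :* r :+ k) :* (u :* u) :* (q :* p :- con 1ℚ))
          ≈-refl (ι k) r q p u))
      (⇝-+ (⇝-* ru⇝σ ru⇝σ) (⇝-* (⇝-ι k) (⇝-* u⇝0 u⇝0)))
      qu⇝ ½C≢0 (pole-value n C k)
    [ru]⁴⇝ : (r * u) * (r * u) * ((r * u) * (r * u)) ⇝ σ ℚ.* σ ℚ.* (σ ℚ.* σ)
    [ru]⁴⇝ = ⇝-* (⇝-* ru⇝σ ru⇝σ) (⇝-* ru⇝σ ru⇝σ)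
    σ⁴≢0 : σ ℚ.* σ ℚ.* (σ ℚ.* σ) ≢ 0ℚ
    σ⁴≢0 = ℚ-*-nonzero (ℚ-*-nonzero σ≢0 σ≢0) (ℚ-*-nonzero σ≢0 σ≢0)
    -- By the curve equation Q q² = r⁴ + a, and u⁴ times this has residue σ⁴.
    Q≁0 : Q ≁ 𝟘
    Q≁0 = *≁0⇒≁0ˡ (⇝⇒≁0 (⇝-resp
      (modulo (- u⁴) Qq²~ (solve 5 (λ a Q r q u →
        (r :* u) :* (r :* u) :* ((r :* u) :* (r :* u)) :+ a :* (u :* u :* (u :* u))
        := Q :* (q :* q :* (u :* u :* (u :* u)))
           :+ (:- (u :* u :* (u :* u))) :* (Q :* (q :* q) :- (r :* r :* (r :* r) :+ a))) ≈-refl (ι a) Q r q u))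
      (⇝-value (trans (cong (σ ℚ.* σ ℚ.* (σ ℚ.* σ) ℚ.+_) (ℚ.*-zeroʳ a)) (ℚ.+-identityʳ _))
        (⇝-+ [ru]⁴⇝ (⇝-* (⇝-ι a) u⁴⇝0)))) σ⁴≢0)
    κ⇝0 : ι a * (j * j * (j * j)) ⇝ 0ℚ
    κ⇝0 = ⇝-quotient
      (modulo (ι a * u⁴ * ((r * j + 𝟙) * (r * j * (r * j) + 𝟙))) rj~1
        (solve 4 (λ a r j u → a :* (j :* j :* (j :* j)) :* ((r :* u) :* (r :* u) :* ((r :* u) :* (r :* u)))
          := a :* (u :* u :* (u :* u))
             :+ a :* (u :* u :* (u :* u)) :* ((r :* j :+ con 1ℚ) :* (r :* j :* (r :* j) :+ con 1ℚ)) :* (r :* j :- con 1ℚ))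
          ≈-refl (ι a) r j u))
      (⇝-* (⇝-ι a) u⁴⇝0) [ru]⁴⇝ σ⁴≢0 (trans (ℚ.*-zeroˡ (σ ℚ.* σ ℚ.* (σ ℚ.* σ))) (sym (ℚ.*-zeroʳ a)))

  section-exists : ∀ f {a} β h D E → a ≢ 0ℚ → (∀ x → evaluate f x ~ depressed a β h D E x) →
                   ¬ (h ≡ 0ℚ × D ≡ 0ℚ × E ≡ 0ℚ) → Section f
  section-exists f {a} β h D E a≢0 f~ not-fourth-power with D ℚ.≟ 0ℚ
  ... | no  D≢0 = section-of-non-even f f~ a≢0 D≢0
  ... | yes refl with E ℚ.≟ 0ℚ
  ...   | no  E≢0 = section-of-even f f~ a≢0 E≢0
  ...   | yes refl with h ℚ.≟ 0ℚ
  ...     | yes h≡0 = contradiction (h≡0 , refl , refl) not-fourth-power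
  ...     | no  h≢0 with a ℚ.- ½ ℚ.* (h ℚ.* (1ℚ ℚ.* 1ℚ)) ℚ.* (½ ℚ.* (h ℚ.* (1ℚ ℚ.* 1ℚ))) ℚ.≟ 0ℚ
  ...       | no  a-k²≢0 = section-of-square f 1ℚ f~ a≢0 h≢0 (λ ()) a-k²≢0
  ...       | yes a-k²≡0 = section-of-square f 2ℚ f~ a≢0 h≢0 (λ ()) (square-gap {a} {h} h≢0 a-k²≡0)

-- Complex roots

module GaussianRationals where
  open import Data.Rational using (_+_; _*_; -_; _-_; _<_; _≤_; ∣_∣)
  open +-*-Solver

  infixl 6 _⊕_
  infixl 7 _⊗_
  _⊕_ _⊗_ : ℚ × ℚ → ℚ × ℚ → ℚ × ℚ
  (a , b) ⊕ (c , d) = a + c , b + d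
  (a , b) ⊗ (c , d) = a * c - b * d , a * d + b * c

  ⊖_ : ℚ × ℚ → ℚ × ℚ
  ⊖ (a , b) = - a , - b

  ⊕-⊗-isCommutativeRing : IsCommutativeRing _≡_ _⊕_ _⊗_ ⊖_ (0ℚ , 0ℚ) (1ℚ , 0ℚ)
  ⊕-⊗-isCommutativeRing = record
    { isRing = record
      { +-isAbelianGroup = record
        { isGroup = record
          { isMonoid = record
            { isSemigroup = record
              { isMagma = record { isEquivalence = isEquivalence ; ∙-cong = cong₂ _⊕_ }
              ; assoc = λ (a , b) (c , d) (e , f) → cong₂ _,_ (ℚ.+-assoc a c e) (ℚ.+-assoc b d f) }
            ; identity = (λ (a , b) → cong₂ _,_ (ℚ.+-identityˡ a) (ℚ.+-identityˡ b))
                       , (λ (a , b) → cong₂ _,_ (ℚ.+-identityʳ a) (ℚ.+-identityʳ b)) }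
          ; inverse = (λ (a , b) → cong₂ _,_ (ℚ.+-inverseˡ a) (ℚ.+-inverseˡ b))
                    , (λ (a , b) → cong₂ _,_ (ℚ.+-inverseʳ a) (ℚ.+-inverseʳ b))
          ; ⁻¹-cong = cong ⊖_ }
        ; comm = λ (a , b) (c , d) → cong₂ _,_ (ℚ.+-comm a c) (ℚ.+-comm b d) }
      ; *-cong = cong₂ _⊗_
      ; *-assoc = λ (a , b) (c , d) (e , f) → cong₂ _,_
          (solve 6 (λ a b c d e f → (a :* c :- b :* d) :* e :- (a :* d :+ b :* c) :* f
                                 := a :* (c :* e :- d :* f) :- b :* (c :* f :+ d :* e)) refl a b c d e f)
          (solve 6 (λ a b c d e f → (a :* c :- b :* d) :* f :+ (a :* d :+ b :* c) :* e
                                 := a :* (c :* f :+ d :* e) :+ b :* (c :* e :- d :* f)) refl a b c d e f)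
      ; *-identity = (λ (a , b) → cong₂ _,_ (solve 2 (λ a b → con 1ℚ :* a :- con 0ℚ :* b := a) refl a b)
                                            (solve 2 (λ a b → con 1ℚ :* b :+ con 0ℚ :* a := b) refl a b))
                   , (λ (a , b) → cong₂ _,_ (solve 2 (λ a b → a :* con 1ℚ :- b :* con 0ℚ := a) refl a b)
                                            (solve 2 (λ a b → a :* con 0ℚ :+ b :* con 1ℚ := b) refl a b))
      ; distrib = (λ (a , b) (c , d) (e , f) → cong₂ _,_
            (solve 6 (λ a b c d e f → a :* (c :+ e) :- b :* (d :+ f) := (a :* c :- b :* d) :+ (a :* e :- b :* f)) refl a b c d e f)
            (solve 6 (λ a b c d e f → a :* (d :+ f) :+ b :* (c :+ e) := (a :* d :+ b :* c) :+ (a :* f :+ b :* e)) refl a b c d e f))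
        , (λ (a , b) (c , d) (e , f) → cong₂ _,_
            (solve 6 (λ a b c d e f → (c :+ e) :* a :- (d :+ f) :* b := (c :* a :- d :* b) :+ (e :* a :- f :* b)) refl a b c d e f)
            (solve 6 (λ a b c d e f → (c :+ e) :* b :+ (d :+ f) :* a := (c :* b :+ d :* a) :+ (e :* b :+ f :* a)) refl a b c d e f)) }
    ; *-comm = λ (a , b) (c , d) → cong₂ _,_
        (solve 4 (λ a b c d → a :* c :- b :* d := c :* a :- d :* b) refl a b c d)
        (solve 4 (λ a b c d → a :* d :+ b :* c := c :* b :+ d :* a) refl a b c d) }

  ℚ[i] : ℚ-Algebra
  ℚ[i] = record
    { commutativeRing = record { isCommutativeRing = ⊕-⊗-isCommutativeRing }
    ; ι     = _, 0ℚ
    ; ι-+   = λ p q → refl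
    ; ι-*   = λ p q → cong₂ _,_ (solve 2 (λ p q → p :* q := p :* q :- con 0ℚ :* con 0ℚ) refl p q)
                                (solve 2 (λ p q → con 0ℚ := p :* con 0ℚ :+ con 0ℚ :* q) refl p q)
    ; ι-neg = λ p → refl
    ; ι-0   = refl
    ; ι-1   = refl }

  norm : ℚ × ℚ → ℚ
  norm (a , b) = a * a + b * b

  open ℚ-Algebra ℚ[i] using (evaluate)
  open QuarticEvaluation ℚ[i] using (depressed)

  approximation : ℂ → ℕ → ℚ × ℚ
  approximation z n = seq (re z) n , seq (im z) n

  -- The operations of `ℂ` act termwise on the sequences, so each term of f(z) is an exact value of
  -- f at a Gaussian rational. Questions about roots thereby become identities and estimates over ℚ.
  approximation-evaluate : ∀ f z n →
    approximation (evalWith ιᶜ _+ᶜ_ _*ᶜ_ f z) n ≡ evaluate f (approximation z n)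
  approximation-evaluate []      z n = refl
  approximation-evaluate (a ∷ f) z n =
    cong (λ w → (a , 0ℚ) ⊕ approximation z n ⊗ w) (approximation-evaluate f z n)

  -- Multiplicativity of the norm, applied to a (t + β)⁴. The auxiliary terms spell out the real and
  -- imaginary parts as `depressed` computes them, zero summands included.
  norm-depressed : ∀ a β x y → let N = norm (x + β , y) in
                   norm (depressed a β 0ℚ 0ℚ 0ℚ (x , y)) ≡ a * a * (N * N * (N * N))
  norm-depressed = solve 4 (λ a β x y →
    let X = x :+ β ; Y = y :+ con 0ℚ
        V = X :* X :- Y :* Y :+ con 0ℚ ; W = X :* Y :+ Y :* X :+ con 0ℚ
        R = V :* V :- W :* W :+ (con 0ℚ :* X :- con 0ℚ :* Y) :+ con 0ℚ
        I = V :* W :+ W :* V :+ (con 0ℚ :* Y :+ con 0ℚ :* X) :+ con 0ℚ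
        N = (x :+ β) :* (x :+ β) :+ y :* y in
    (a :* R :- con 0ℚ :* I) :* (a :* R :- con 0ℚ :* I) :+ (a :* I :+ con 0ℚ :* R) :* (a :* I :+ con 0ℚ :* R)
    := a :* a :* (N :* N :* (N :* N))) refl

  square-mono : ∀ {p q} → 0ℚ ≤ p → p ≤ q → p * p ≤ q * q
  square-mono {p} {q} 0≤p p≤q = ℚ.≤-trans
    (ℚ.*-monoˡ-≤-nonNeg p {{ℚ.nonNegative 0≤p}} p≤q)
    (ℚ.*-monoʳ-≤-nonNeg q {{ℚ.nonNegative (ℚ.≤-trans 0≤p p≤q)}} p≤q)

  0≤square : ∀ p → 0ℚ ≤ p * p
  0≤square p with magnitude p
  ... | b , 0≤b , _ , _ , bb≡pp = subst (0ℚ ≤_) bb≡pp (0≤* 0≤b 0≤b)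

  ∣∣-square : ∀ p → ∣ p ∣ * ∣ p ∣ ≡ p * p
  ∣∣-square p = trans (sym (ℚ.∣p*q∣≡∣p∣*∣q∣ p p)) (ℚ.0≤p⇒∣p∣≡p (0≤square p))

  -- If N ≥ ε², the right side of the norm equation is at least a² ε⁸, while R² + I² ≤ 2 δ² = a² ε⁸
  -- / 2. The factor ½ in δ provides this gap.
  fourth-root-small : ∀ {a ε R I N} → a ≢ 0ℚ → 0ℚ < ε →
    let δ = ½ * (∣ a ∣ * (ε * ε * (ε * ε))) in
    ∣ R ∣ < δ → ∣ I ∣ < δ → R * R + I * I ≡ a * a * (N * N * (N * N)) → N < ε * ε
  fourth-root-small {a} {ε} {R} {I} {N} a≢0 0<ε R<δ I<δ norm≡ = ℚ.≰⇒> λ ε²≤N →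
    let ε⁸≤N⁴ = square-mono (0≤square (ε * ε)) (square-mono (0≤square ε) ε²≤N) in
    ℚ.<-irrefl refl (begin-strict
      R * R + I * I                  ≡⟨ cong₂ _+_ (∣∣-square R) (∣∣-square I) ⟨
      ∣ R ∣ * ∣ R ∣ + ∣ I ∣ * ∣ I ∣  ≤⟨ ℚ.+-mono-≤ (square-mono (ℚ.0≤∣p∣ R) (ℚ.<⇒≤ R<δ)) (square-mono (ℚ.0≤∣p∣ I) (ℚ.<⇒≤ I<δ)) ⟩
      δ * δ + δ * δ                  ≡⟨ solve 2 (λ b e → (con ½ :* (b :* e)) :* (con ½ :* (b :* e)) :+ (con ½ :* (b :* e)) :* (con ½ :* (b :* e))
                                          := con ½ :* (b :* b :* (e :* e))) refl ∣ a ∣ (ε * ε * (ε * ε)) ⟩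
      ½ * (∣ a ∣ * ∣ a ∣ * ε⁸)       ≡⟨ cong (λ b → ½ * (b * ε⁸)) (∣∣-square a) ⟩
      ½ * (a * a * ε⁸)               <⟨ ℚ.*-monoˡ-<-pos (a * a * ε⁸) {{a²ε⁸-pos}} ½<1 ⟩
      1ℚ * (a * a * ε⁸)              ≡⟨ ℚ.*-identityˡ (a * a * ε⁸) ⟩
      a * a * ε⁸                     ≤⟨ ℚ.*-monoˡ-≤-nonNeg (a * a) {{ℚ.nonNegative (0≤square a)}} ε⁸≤N⁴ ⟩
      a * a * (N * N * (N * N))      ≡⟨ norm≡ ⟨
      R * R + I * I                  ∎)
    where
    open ℚ.≤-Reasoning
    δ ε⁸ : ℚ
    δ  = ½ * (∣ a ∣ * (ε * ε * (ε * ε)))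
    ε⁸ = (ε * ε * (ε * ε)) * (ε * ε * (ε * ε))
    ½<1 : ½ < 1ℚ
    ½<1 = from-yes (½ ℚ.<? 1ℚ)
    ε≢0 : ε ≢ 0ℚ
    ε≢0 ε≡0 = ℚ.<-irrefl (sym ε≡0) 0<ε
    ε⁴≢0 : ε * ε * (ε * ε) ≢ 0ℚ
    ε⁴≢0 = ℚ-*-nonzero (ℚ-*-nonzero ε≢0 ε≢0) (ℚ-*-nonzero ε≢0 ε≢0)
    a²ε⁸-pos : ℚ.Positive (a * a * ε⁸)
    a²ε⁸-pos = ℚ.nonNeg∧nonZero⇒pos (a * a * ε⁸)
      {{ℚ.nonNegative (0≤* (0≤square a) (0≤square (ε * ε * (ε * ε))))}}
      {{ℚ.≢-nonZero (ℚ-*-nonzero (ℚ-*-nonzero a≢0 a≢0) (ℚ-*-nonzero ε⁴≢0 ε⁴≢0))}}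

  square<⇒∣∣< : ∀ {p ε} → 0ℚ < ε → p * p < ε * ε → ∣ p ∣ < ε
  square<⇒∣∣< {p} {ε} 0<ε pp<εε = ℚ.≰⇒> λ ε≤∣p∣ →
    ℚ.<-irrefl refl (ℚ.<-≤-trans pp<εε (subst (ε * ε ≤_) (∣∣-square p) (square-mono (ℚ.<⇒≤ 0<ε) ε≤∣p∣)))

  root-of-fourth-power : ∀ f {a β} → a ≢ 0ℚ → (∀ x → evaluate f x ≡ depressed a β 0ℚ 0ℚ 0ℚ x) →
    ∀ z → IsRoot f z → ∀ ε → 0ℚ < ε →
    ∃ λ M → ∀ n → M ℕ.≤ n → ∣ seq (re z) n + β ∣ < ε × ∣ seq (im z) n ∣ < ε
  root-of-fourth-power f {a} {β} a≢0 f≡ z (re≈0 , im≈0) ε 0<ε =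
    let M₁ , re< = re≈0 δ δ-pos
        M₂ , im< = im≈0 δ δ-pos
    in M₁ ℕ.⊔ M₂ , λ n M≤n →
    let R = seq (re (evalWith ιᶜ _+ᶜ_ _*ᶜ_ f z)) n
        I = seq (im (evalWith ιᶜ _+ᶜ_ _*ᶜ_ f z)) n
        x = seq (re z) n
        y = seq (im z) n
        N<ε² = fourth-root-small a≢0 0<ε
          -- Being a root bounds the difference from the zero sequence, hence R - 0 rather than R.
          (subst (λ e → ∣ e ∣ < δ) (ℚ.+-identityʳ R) (re< n (ℕ.m⊔n≤o⇒m≤o M₁ M₂ M≤n)))
          (subst (λ e → ∣ e ∣ < δ) (ℚ.+-identityʳ I) (im< n (ℕ.m⊔n≤o⇒n≤o M₁ M₂ M≤n)))
          (trans (cong norm (trans (approximation-evaluate f z n) (f≡ (x , y)))) (norm-depressed a β x y))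
    in square<⇒∣∣< 0<ε (ℚ.≤-<-trans (≤-+ʳ (0≤square y)) N<ε²)
     , square<⇒∣∣< 0<ε (ℚ.≤-<-trans (≤-+ˡ (0≤square (x + β))) N<ε²)
    where
    ≤-+ʳ : ∀ {p q} → 0ℚ ≤ q → p ≤ p + q
    ≤-+ʳ {p} {q} 0≤q = subst (_≤ p + q) (ℚ.+-identityʳ p) (ℚ.+-monoʳ-≤ p 0≤q)
    ≤-+ˡ : ∀ {p q} → 0ℚ ≤ p → q ≤ p + q
    ≤-+ˡ {p} {q} 0≤p = subst (_≤ p + q) (ℚ.+-identityˡ q) (ℚ.+-monoˡ-≤ q 0≤p)
    ε≢0 : ε ≢ 0ℚ
    ε≢0 ε≡0 = ℚ.<-irrefl (sym ε≡0) 0<ε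
    δ : ℚ
    δ = ½ * (∣ a ∣ * (ε * ε * (ε * ε)))
    δ-pos : 0ℚ < δ
    δ-pos = ℚ.positive⁻¹ δ {{ℚ.nonNeg∧nonZero⇒pos δ
      {{ℚ.nonNegative (0≤* {½} (ℚ.nonNegative⁻¹ ½) (0≤* (ℚ.0≤∣p∣ a) (0≤square (ε * ε))))}}
      {{ℚ.≢-nonZero (ℚ-*-nonzero {½} (λ ()) (ℚ-*-nonzero (λ ∣a∣≡0 → a≢0 (ℚ.∣p∣≡0⇒p≡0 a ∣a∣≡0))
        (ℚ-*-nonzero (ℚ-*-nonzero ε≢0 ε≢0) (ℚ-*-nonzero ε≢0 ε≢0))))}}}}

  close : ∀ {ε} c x y → ∣ x + c ∣ < ½ * ε → ∣ y + c ∣ < ½ * ε → ∣ x - y ∣ < ε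
  close {ε} c x y x< y< = begin-strict
    ∣ x - y ∣               ≡⟨ cong ∣_∣ (solve 3 (λ c x y → x :- y := (x :+ c) :- (y :+ c)) refl c x y) ⟩
    ∣ (x + c) - (y + c) ∣   ≤⟨ ℚ.∣p-q∣≤∣p∣+∣q∣ (x + c) (y + c) ⟩
    ∣ x + c ∣ + ∣ y + c ∣   <⟨ ℚ.+-mono-< x< y< ⟩
    ½ * ε + ½ * ε           ≡⟨ solve 1 (λ ε → con ½ :* ε :+ con ½ :* ε := ε) refl ε ⟩
    ε                       ∎
    where open ℚ.≤-Reasoning

  -- The approximations of both roots converge to -β, so eventually they lie within ε / 2 of it and
  -- within ε of each other.
  fourth-power-one-root : ∀ f {a β} → a ≢ 0ℚ → (∀ x → evaluate f x ≡ depressed a β 0ℚ 0ℚ 0ℚ x) →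
                          ¬ TwoDistinctComplexRoots f
  fourth-power-one-root f {a} {β} a≢0 f≡ (z , w , z≉w , z-root , w-root) = z≉w
    ( (λ ε 0<ε → let M , bounds = common ε 0<ε in M , λ n M≤n →
        let (x< , _) , (x′< , _) = bounds n M≤n in close β (seq (re z) n) (seq (re w) n) x< x′<)
    , (λ ε 0<ε → let M , bounds = common ε 0<ε in M , λ n M≤n →
        let (_ , y<) , (_ , y′<) = bounds n M≤n in close 0ℚ (seq (im z) n) (seq (im w) n) (add-0 y<) (add-0 y′<)) )
    where
    add-0 : ∀ {p ε} → ∣ p ∣ < ε → ∣ p + 0ℚ ∣ < ε
    add-0 {p} {ε} = subst (λ q → ∣ q ∣ < ε) (sym (ℚ.+-identityʳ p))
    Near : ℂ → ℚ → ℕ → Set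
    Near z ε n = ∣ seq (re z) n + β ∣ < ½ * ε × ∣ seq (im z) n ∣ < ½ * ε
    common : ∀ ε → 0ℚ < ε → ∃ λ M → ∀ n → M ℕ.≤ n → Near z ε n × Near w ε n
    common ε 0<ε =
      let 0<½ε = subst (_< ½ * ε) (ℚ.*-zeroʳ ½) (ℚ.*-monoʳ-<-pos ½ 0<ε)
          M₁ , z< = root-of-fourth-power f a≢0 f≡ z z-root (½ * ε) 0<½ε
          M₂ , w< = root-of-fourth-power f a≢0 f≡ w w-root (½ * ε) 0<½ε
      in M₁ ℕ.⊔ M₂ , λ n M≤n → z< n (ℕ.m⊔n≤o⇒m≤o M₁ M₂ M≤n) , w< n (ℕ.m⊔n≤o⇒n≤o M₁ M₂ M≤n)

-- From the polynomial to its section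

depress-polynomial : ∀ f → HasDegree f 4 → Depressed (coeff f 0) (coeff f 1) (coeff f 2) (coeff f 3) (coeff f 4)
depress-polynomial f (a≢0 , _) = depress (coeff f 0) (coeff f 1) (coeff f 2) (coeff f 3) a≢0

-- The same β, h, D, E serve every algebra: over `ℚ⟨X⟩` the identity feeds the construction of the
-- section, over the Gaussian rationals it ties h = D = E = 0 to the complex roots.
depressed-form : ∀ f (deg : HasDegree f 4) (𝔸 : ℚ-Algebra) →
  let open Depressed (depress-polynomial f deg)
      open ℚ-Algebra 𝔸
      open QuarticEvaluation 𝔸 in
  ∀ x → evaluate f x ~ depressed (coeff f 4) β h D E x
depressed-form f deg 𝔸 x = ≈-trans (evaluate-quartic f x deg) (horner₄-depressed (depress-polynomial f deg) x)
  where
  open ℚ-Algebra 𝔸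
  open QuarticEvaluation 𝔸

section⇒nonTorsion : ∀ f → Sections.Section ℚ⟨X⟩-at-0 f →
    ∃ λ (φ : RatFun) → NonConstant φ × (∃ λ (P : Point) → OnCurve (f ∘ᵣ φ) (const 0ℚ) P × NonTorsion (f ∘ᵣ φ) P)
section⇒nonTorsion f s =
    φ
  , (λ (c , φ≈c) → non-constant c (≈⇒≃ {φ} {const c} φ≈c))
  , affine x y
  , ≃⇒≈ {y *ᵣ y} {x *ᵣ x *ᵣ x +ᵣ (f ∘ᵣ φ) *ᵣ x +ᵣ const 0ℚ} on-curve
  , reduces⇒nonTorsion (coefficient-reduces {f ∘ᵣ φ} {x} {y} {κ} on-curve x≁0 coefficient κ⇝0)
      (section-reduces {f ∘ᵣ φ} {x} {y} {κ} on-curve x≁0 coefficient κ⇝0)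
  where
  open Sections ℚ⟨X⟩-at-0
  open Section s

not-fourth-power : ∀ f {a β h D E} → a ≢ 0ℚ → TwoDistinctComplexRoots f →
  let open ℚ-Algebra GaussianRationals.ℚ[i]
      open QuarticEvaluation GaussianRationals.ℚ[i] in
  (∀ x → evaluate f x ≡ depressed a β h D E x) → ¬ (h ≡ 0ℚ × D ≡ 0ℚ × E ≡ 0ℚ)
not-fourth-power f {a} {β} a≢0 roots f≡ (refl , refl , refl) =
  GaussianRationals.fourth-power-one-root f {a} {β} a≢0 f≡ roots

theorem2p2 : (f : Poly) → TwoDistinctComplexRoots f → HasDegree f 4 → ¬ (f ≈ₚ f ∘ₚ (-ₚ X)) →
    ∃ λ (φ : RatFun) → NonConstant φ × (∃ λ (P : Point) → OnCurve (f ∘ᵣ φ) (const 0ℚ) P × NonTorsion (f ∘ᵣ φ) P)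
theorem2p2 f roots deg@(a≢0 , _) _ = section⇒nonTorsion f
  (Constructions.section-exists ℚ⟨X⟩-at-0 f β h D E a≢0 (depressed-form f deg ℚ⟨X⟩)
    (not-fourth-power f {β = β} a≢0 roots (depressed-form f deg GaussianRationals.ℚ[i])))
  where open Depressed (depress-polynomial f deg)
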